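{- For every integer $n\geq 2$, \[ U_n=T_n^\perp . \] In other words, a function $f:S_n\to\mathbb R$ belongs to $U_n$ if and only if $\sum_{\sigma\in L}f(\sigma)$ is independent of the one-factorization $L\in\mathcal L_n$. Equivalently, this holds if and only if there are $c\in\mathbb R$ and $a_{i,j}\in\mathbb R$ ($i,j\in[n]$) such that \[ f(\sigma)=c+\sum_{i=1}^n a_{i,\sigma(i)}\qquad(\sigma\in S_n). \]
   Context: $S_n$ is the symmetric group on $[n]=\{1,\ldots,n\}$. Two permutations $\sigma,\tau\in S_n$ are disjoint if $\sigma(i)\neq\tau(i)$ for every $i\in[n]$. A one-factorization is a set $L\subseteq S_n$ of $n$ pairwise disjoint permutations; $\mathcal L_n$ is the set of all one-factorizations. For $i,j\in[n]$, $x_{i,j}:S_n\to\mathbb R$ is the function with $x_{i,j}(\sigma)=1$ if $\sigma(i)=j$ and $0$ otherwise, and $U_n=\operatorname{span}_{\mathbb R}\{x_{i,j}:i,j\in[n]\}$. The space $\mathbb R^{S_n}$ carries the inner product $\langle f,g\rangle=\sum_{\sigma\in S_n}f(\sigma)g(\sigma)$. For $L\in\mathcal L_n$, $v_L=\mathbf 1_L\in\mathbb R^{S_n}$ is the indicator function of $L$, and $T_n=\operatorname{span}_{\mathbb R}\{v_L-v_{L'}:L,L'\in\mathcal L_n\}$; $T_n^\perp$ is its orthogonal complement in $\mathbb R^{S_n}$. -}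

module Defs where

open import Algebra.Bundles using (CommutativeRing)
open import Algebra.Structures using (IsCommutativeRing)
open import Data.Bool.Base using (Bool; true; if_then_else_)
open import Data.Fin.Base using (Fin; zero; suc; punchIn; combine; remQuot)
open import Data.Fin.Permutation as Perm
  using (Permutation′; _⟨$⟩ʳ_; insert; remove; insert-remove; remove-insert; insert-punchIn)
open import Data.Fin.Properties
  using (_≟_; remQuot-combine; combine-remQuot; punchIn-injective)
open import Data.Nat.Base as ℕ using (ℕ; zero; suc; _!)
import Data.Nat.Properties as ℕ
open import Data.Product.Base using (Σ; ∃; ∃-syntax; _×_; _,_; proj₁; proj₂; uncurry)
open import Data.Rational.Base as ℚ using (ℚ; 0ℚ; 1ℚ; ½)
import Data.Rational.Properties as ℚ
open import Data.Rational.Solver using (module +-*-Solver)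
open import Function.Bundles using (Func; Inverse)
open import Level using (0ℓ)
open import Relation.Binary.Bundles using (Setoid)
import Relation.Binary.Construct.On as On
open import Relation.Binary.PropositionalEquality
  using (_≡_; _≢_; refl; sym; trans; cong; cong₂; subst; module ≡-Reasoning)
import Relation.Binary.PropositionalEquality.Properties as ≡
open import Relation.Nullary using (¬_; does)
open import Relation.Unary using (Pred; _∈_)

-- The real numbers, as the Cauchy completion of ℚ: Cauchy sequences of
-- rationals, two of them being equal when their difference tends to 0.
-- The operations are pointwise.  The abstract blocks and the absence of eta
-- only keep the typechecker from unfolding convergence proofs.

IsCauchy : (ℕ → ℚ) → Set
IsCauchy x = ∀ ε → 0ℚ ℚ.< ε →
  ∃[ N ] (∀ m n → N ℕ.≤ m → N ℕ.≤ n → ℚ.∣ x m ℚ.- x n ∣ ℚ.< ε)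

record ℝ : Set where
  no-eta-equality
  constructor mkℝ
  field
    seq    : ℕ → ℚ
    cauchy : IsCauchy seq

open ℝ public

infix 4 _≈ℝ_
record _≈ℝ_ (x y : ℝ) : Set where
  constructor mk≈
  field
    close : ∀ ε → 0ℚ ℚ.< ε →
      ∃[ N ] (∀ n → N ℕ.≤ n → ℚ.∣ seq x n ℚ.- seq y n ∣ ℚ.< ε)

open _≈ℝ_ public

-- Double sequences tending to 0 cover both the Cauchy condition (x m - x n)
-- and equality (x n - y n, constant in m).
Small : (ℕ → ℕ → ℚ) → Set
Small d = ∀ ε → 0ℚ ℚ.< ε →
  ∃[ N ] (∀ m n → N ℕ.≤ m → N ℕ.≤ n → ℚ.∣ d m n ∣ ℚ.< ε)

Bounded : (ℕ → ℕ → ℚ) → Set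
Bounded b = ∃[ B ] (0ℚ ℚ.< B) ×
  ∃[ N ] (∀ m n → N ℕ.≤ m → N ℕ.≤ n → ℚ.∣ b m n ∣ ℚ.≤ B)

abstract
  small-ext : ∀ {d e} → (∀ m n → d m n ≡ e m n) → Small d → Small e
  small-ext d≡e sd ε ε>0 with sd ε ε>0
  ... | N , p = N , λ m n N≤m N≤n →
    subst (λ q → ℚ.∣ q ∣ ℚ.< ε) (d≡e m n) (p m n N≤m N≤n)

  small-0 : Small (λ _ _ → 0ℚ)
  small-0 ε ε>0 = 0 , λ _ _ _ _ → ε>0

  ½*-pos : ∀ ε → 0ℚ ℚ.< ε → 0ℚ ℚ.< ½ ℚ.* ε
  ½*-pos ε ε>0 = subst (ℚ._< ½ ℚ.* ε) (ℚ.*-zeroʳ ½) (ℚ.*-monoʳ-<-pos ½ ε>0)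

  ½+½ : ∀ ε → ½ ℚ.* ε ℚ.+ ½ ℚ.* ε ≡ ε
  ½+½ ε = trans (sym (ℚ.*-distribʳ-+ ε ½ ½)) (ℚ.*-identityˡ ε)

  small-+ : ∀ {d e} → Small d → Small e → Small (λ m n → d m n ℚ.+ e m n)
  small-+ {d} {e} sd se ε ε>0
    with sd (½ ℚ.* ε) (½*-pos ε ε>0) | se (½ ℚ.* ε) (½*-pos ε ε>0)
  ... | N , p | N′ , p′ = N ℕ.⊔ N′ , λ m n N≤m N≤n →
    ℚ.≤-<-trans (ℚ.∣p+q∣≤∣p∣+∣q∣ (d m n) (e m n))
      (subst (ℚ.∣ d m n ∣ ℚ.+ ℚ.∣ e m n ∣ ℚ.<_) (½+½ ε)
        (ℚ.+-mono-<
          (p m n (ℕ.m⊔n≤o⇒m≤o N N′ N≤m) (ℕ.m⊔n≤o⇒m≤o N N′ N≤n))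
          (p′ m n (ℕ.m⊔n≤o⇒n≤o N N′ N≤m) (ℕ.m⊔n≤o⇒n≤o N N′ N≤n))))

  small-neg : ∀ {d} → Small d → Small (λ m n → ℚ.- d m n)
  small-neg {d} sd ε ε>0 with sd ε ε>0
  ... | N , p = N , λ m n N≤m N≤n →
    subst (ℚ._< ε) (sym (ℚ.∣-p∣≡∣p∣ (d m n))) (p m n N≤m N≤n)

  small-* : ∀ {b d} → Bounded b → Small d → Small (λ m n → b m n ℚ.* d m n)
  small-* {b} {d} (B , B>0 , N , p) sd ε ε>0 with sd δ δ>0
    where
    instance
      B-pos : ℚ.Positive B
      B-pos = ℚ.positive B>0
      B-nonZero : ℚ.NonZero B
      B-nonZero = ℚ.pos⇒nonZero B
      B⁻¹-pos : ℚ.Positive (ℚ.1/ B)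
      B⁻¹-pos = ℚ.1/pos⇒pos B
    δ : ℚ
    δ = (ℚ.1/ B) ℚ.* ε
    δ>0 : 0ℚ ℚ.< δ
    δ>0 = subst (ℚ._< δ) (ℚ.*-zeroʳ (ℚ.1/ B)) (ℚ.*-monoʳ-<-pos (ℚ.1/ B) ε>0)
  ... | N′ , p′ = N ℕ.⊔ N′ , λ m n N≤m N≤n →
    bound m n (p m n (ℕ.m⊔n≤o⇒m≤o N N′ N≤m) (ℕ.m⊔n≤o⇒m≤o N N′ N≤n))
              (p′ m n (ℕ.m⊔n≤o⇒n≤o N N′ N≤m) (ℕ.m⊔n≤o⇒n≤o N N′ N≤n))
    where
    instance
      B-pos : ℚ.Positive B
      B-pos = ℚ.positive B>0
      B-nonZero : ℚ.NonZero B
      B-nonZero = ℚ.pos⇒nonZero B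
    bound : ∀ m n → ℚ.∣ b m n ∣ ℚ.≤ B → ℚ.∣ d m n ∣ ℚ.< (ℚ.1/ B) ℚ.* ε →
            ℚ.∣ b m n ℚ.* d m n ∣ ℚ.< ε
    bound m n b≤B d<δ = begin-strict
      ℚ.∣ b m n ℚ.* d m n ∣        ≡⟨ ℚ.∣p*q∣≡∣p∣*∣q∣ (b m n) (d m n) ⟩
      ℚ.∣ b m n ∣ ℚ.* ℚ.∣ d m n ∣  ≤⟨ ℚ.*-monoʳ-≤-nonNeg ℚ.∣ d m n ∣ {{ℚ.∣-∣-nonNeg (d m n)}} b≤B ⟩
      B ℚ.* ℚ.∣ d m n ∣            <⟨ ℚ.*-monoʳ-<-pos B d<δ ⟩
      B ℚ.* ((ℚ.1/ B) ℚ.* ε)       ≡⟨ ℚ.*-assoc B (ℚ.1/ B) ε ⟨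
      (B ℚ.* ℚ.1/ B) ℚ.* ε         ≡⟨ cong (ℚ._* ε) (ℚ.*-inverseʳ B) ⟩
      1ℚ ℚ.* ε                     ≡⟨ ℚ.*-identityˡ ε ⟩
      ε                            ∎
      where open ℚ.≤-Reasoning

0<1 : 0ℚ ℚ.< 1ℚ
0<1 = ℚ.positive⁻¹ 1ℚ

abstract
  cauchy-bounded : ∀ {x} → IsCauchy x →
    ∃[ B ] (0ℚ ℚ.< B) × ∃[ N ] (∀ n → N ℕ.≤ n → ℚ.∣ x n ∣ ℚ.≤ B)
  cauchy-bounded {x} cx with cx 1ℚ 0<1
  ... | N , p = 1ℚ ℚ.+ ℚ.∣ x N ∣ , B>0 , N , bound
    where
    open ℚ.≤-Reasoning
    B>0 : 0ℚ ℚ.< 1ℚ ℚ.+ ℚ.∣ x N ∣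
    B>0 = ℚ.+-mono-<-≤ 0<1 (ℚ.0≤∣p∣ (x N))
    split : ∀ a b → a ≡ (a ℚ.- b) ℚ.+ b
    split = solve 2 (λ a b → a := (a :- b) :+ b) refl
      where open +-*-Solver
    bound : ∀ n → N ℕ.≤ n → ℚ.∣ x n ∣ ℚ.≤ 1ℚ ℚ.+ ℚ.∣ x N ∣
    bound n N≤n = begin
      ℚ.∣ x n ∣                         ≡⟨ cong ℚ.∣_∣ (split (x n) (x N)) ⟩
      ℚ.∣ (x n ℚ.- x N) ℚ.+ x N ∣       ≤⟨ ℚ.∣p+q∣≤∣p∣+∣q∣ (x n ℚ.- x N) (x N) ⟩
      ℚ.∣ x n ℚ.- x N ∣ ℚ.+ ℚ.∣ x N ∣   ≤⟨ ℚ.+-monoˡ-≤ ℚ.∣ x N ∣ (ℚ.<⇒≤ (p n N N≤n ℕ.≤-refl)) ⟩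
      1ℚ ℚ.+ ℚ.∣ x N ∣                  ∎

boundedˡ : ∀ x → Bounded (λ m _ → seq x m)
boundedˡ x with cauchy-bounded (cauchy x)
... | B , B>0 , N , p = B , B>0 , N , λ m _ N≤m _ → p m N≤m

boundedʳ : ∀ x → Bounded (λ _ n → seq x n)
boundedʳ x with cauchy-bounded (cauchy x)
... | B , B>0 , N , p = B , B>0 , N , λ _ n _ N≤n → p n N≤n

infixl 6 _+ℝ_
infixl 7 _*ℝ_
infix 8 -ℝ_

sum-difference : ∀ a b c d →
  (a ℚ.- b) ℚ.+ (c ℚ.- d) ≡ (a ℚ.+ c) ℚ.- (b ℚ.+ d)
sum-difference = solve 4 (λ a b c d →
  (a :- b) :+ (c :- d) := (a :+ c) :- (b :+ d)) refl
  where open +-*-Solver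

_+ℝ_ : ℝ → ℝ → ℝ
seq (x +ℝ y) n = seq x n ℚ.+ seq y n
cauchy (x +ℝ y) = small-ext
  (λ m n → sum-difference (seq x m) (seq x n) (seq y m) (seq y n))
  (small-+ (cauchy x) (cauchy y))

-ℝ_ : ℝ → ℝ
seq (-ℝ x) n = ℚ.- seq x n
cauchy (-ℝ x) = small-ext
  (λ m n → ℚ.neg-distrib-+ (seq x m) (ℚ.- seq x n))
  (small-neg (cauchy x))

product-difference : ∀ a b c d →
  a ℚ.* (c ℚ.- d) ℚ.+ d ℚ.* (a ℚ.- b) ≡ a ℚ.* c ℚ.- b ℚ.* d
product-difference = solve 4 (λ a b c d →
  a :* (c :- d) :+ d :* (a :- b) := a :* c :- b :* d) refl
  where open +-*-Solver

_*ℝ_ : ℝ → ℝ → ℝ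
seq (x *ℝ y) n = seq x n ℚ.* seq y n
cauchy (x *ℝ y) = small-ext
  (λ m n → product-difference (seq x m) (seq x n) (seq y m) (seq y n))
  (small-+ (small-* (boundedˡ x) (cauchy y)) (small-* (boundedʳ y) (cauchy x)))

fromℚ : ℚ → ℝ
seq (fromℚ q) _ = q
cauchy (fromℚ q) = small-ext (λ _ _ → sym (ℚ.+-inverseʳ q)) small-0

0ℝ 1ℝ : ℝ
0ℝ = fromℚ 0ℚ
1ℝ = fromℚ 1ℚ

≈⇒small : ∀ {x y} → x ≈ℝ y → Small (λ _ n → seq x n ℚ.- seq y n)
≈⇒small x≈y ε ε>0 with close x≈y ε ε>0
... | N , p = N , λ _ n _ N≤n → p n N≤n

small⇒≈ : ∀ {x y} → Small (λ _ n → seq x n ℚ.- seq y n) → x ≈ℝ y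
close (small⇒≈ s) ε ε>0 with s ε ε>0
... | N , p = N , λ n N≤n → p n n N≤n N≤n

pointwise : ∀ {x y} → (∀ n → seq x n ≡ seq y n) → x ≈ℝ y
pointwise {x} {y} x≡y = small⇒≈ (small-ext
  (λ _ n → sym (trans (cong (ℚ._- seq y n) (x≡y n)) (ℚ.+-inverseʳ (seq y n))))
  small-0)

≈ℝ-refl : ∀ {x} → x ≈ℝ x
≈ℝ-refl = pointwise (λ _ → refl)

≈ℝ-sym : ∀ {x y} → x ≈ℝ y → y ≈ℝ x
≈ℝ-sym {x} {y} x≈y = small⇒≈ (small-ext
  (λ _ n → flip-sub (seq x n) (seq y n)) (small-neg (≈⇒small x≈y)))
  where
  open +-*-Solver
  flip-sub : ∀ a b → ℚ.- (a ℚ.- b) ≡ b ℚ.- a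
  flip-sub = solve 2 (λ a b → :- (a :- b) := b :- a) refl

≈ℝ-trans : ∀ {x y z} → x ≈ℝ y → y ≈ℝ z → x ≈ℝ z
≈ℝ-trans {x} {y} {z} x≈y y≈z = small⇒≈ (small-ext
  (λ _ n → telescope (seq x n) (seq y n) (seq z n))
  (small-+ (≈⇒small x≈y) (≈⇒small y≈z)))
  where
  open +-*-Solver
  telescope : ∀ a b c → (a ℚ.- b) ℚ.+ (b ℚ.- c) ≡ a ℚ.- c
  telescope = solve 3 (λ a b c → (a :- b) :+ (b :- c) := a :- c) refl

+ℝ-cong : ∀ {x y u v} → x ≈ℝ y → u ≈ℝ v → x +ℝ u ≈ℝ y +ℝ v
+ℝ-cong {x} {y} {u} {v} x≈y u≈v = small⇒≈ (small-ext
  (λ _ n → sum-difference (seq x n) (seq y n) (seq u n) (seq v n))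
  (small-+ (≈⇒small x≈y) (≈⇒small u≈v)))

-ℝ-cong : ∀ {x y} → x ≈ℝ y → -ℝ x ≈ℝ -ℝ y
-ℝ-cong {x} {y} x≈y = small⇒≈ (small-ext
  (λ _ n → ℚ.neg-distrib-+ (seq x n) (ℚ.- seq y n))
  (small-neg (≈⇒small x≈y)))

*ℝ-cong : ∀ {x y u v} → x ≈ℝ y → u ≈ℝ v → x *ℝ u ≈ℝ y *ℝ v
*ℝ-cong {x} {y} {u} {v} x≈y u≈v = small⇒≈ (small-ext
  (λ _ n → product-difference (seq x n) (seq y n) (seq u n) (seq v n))
  (small-+ (small-* (boundedʳ x) (≈⇒small u≈v))
           (small-* (boundedʳ v) (≈⇒small x≈y))))

ℝ-isCommutativeRing : IsCommutativeRing _≈ℝ_ _+ℝ_ _*ℝ_ -ℝ_ 0ℝ 1ℝ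
ℝ-isCommutativeRing = record
  { isRing = record
    { +-isAbelianGroup = record
      { isGroup = record
        { isMonoid = record
          { isSemigroup = record
            { isMagma = record
              { isEquivalence = record
                { refl = ≈ℝ-refl ; sym = ≈ℝ-sym ; trans = ≈ℝ-trans }
              ; ∙-cong = +ℝ-cong
              }
            ; assoc = λ x y z → pointwise λ n → ℚ.+-assoc (seq x n) (seq y n) (seq z n)
            }
          ; identity = (λ x → pointwise λ n → ℚ.+-identityˡ (seq x n))
                     , (λ x → pointwise λ n → ℚ.+-identityʳ (seq x n))
          }
        ; inverse = (λ x → pointwise λ n → ℚ.+-inverseˡ (seq x n))
                  , (λ x → pointwise λ n → ℚ.+-inverseʳ (seq x n))
        ; ⁻¹-cong = -ℝ-cong
        }
      ; comm = λ x y → pointwise λ n → ℚ.+-comm (seq x n) (seq y n)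
      }
    ; *-cong = *ℝ-cong
    ; *-assoc = λ x y z → pointwise λ n → ℚ.*-assoc (seq x n) (seq y n) (seq z n)
    ; *-identity = (λ x → pointwise λ n → ℚ.*-identityˡ (seq x n))
                 , (λ x → pointwise λ n → ℚ.*-identityʳ (seq x n))
    ; distrib = (λ x y z → pointwise λ n → ℚ.*-distribˡ-+ (seq x n) (seq y n) (seq z n))
              , (λ x y z → pointwise λ n → ℚ.*-distribʳ-+ (seq x n) (seq y n) (seq z n))
    }
  ; *-comm = λ x y → pointwise λ n → ℚ.*-comm (seq x n) (seq y n)
  }

ℝ-commutativeRing : CommutativeRing 0ℓ 0ℓ
ℝ-commutativeRing = record { isCommutativeRing = ℝ-isCommutativeRing }

open CommutativeRing ℝ-commutativeRing public
  using () renaming (setoid to ℝ-setoid; +-monoid to ℝ-+-monoid; _-_ to _-ℝ_)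

open import Algebra.Properties.Monoid.Sum ℝ-+-monoid public
  using (sum; sum-syntax; sum-cong-≋)

-- S_n, with Fin n for [n]; permutations are equal when they agree pointwise.

Sym : ℕ → Setoid 0ℓ 0ℓ
Sym n = record
  { Carrier       = Permutation′ n
  ; _≈_           = Perm._≈_
  ; isEquivalence = record
    { refl  = λ _ → refl
    ; sym   = λ p i → sym (p i)
    ; trans = λ p q i → trans (p i) (q i)
    }
  }

Disjoint : ∀ {n} → Permutation′ n → Permutation′ n → Set
Disjoint σ τ = ∀ i → σ ⟨$⟩ʳ i ≢ τ ⟨$⟩ʳ i

insert-cong : ∀ {n} (j : Fin (suc n)) {π ρ : Permutation′ n} →
  π Perm.≈ ρ → insert zero j π Perm.≈ insert zero j ρ
insert-cong j π≈ρ zero    = refl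
insert-cong {suc _} j {π} {ρ} π≈ρ (suc k) = trans (insert-punchIn zero j π k)
  (trans (cong (punchIn j) (π≈ρ k)) (sym (insert-punchIn zero j ρ k)))

remove-cong : ∀ {n} {π ρ : Permutation′ (suc n)} →
  π Perm.≈ ρ → remove zero π Perm.≈ remove zero ρ
remove-cong {n} {π} {ρ} π≈ρ k = punchIn-injective (π ⟨$⟩ʳ zero) _ _
  (trans (sym (Perm.punchIn-permute π zero k))
  (trans (π≈ρ (suc k))
  (trans (Perm.punchIn-permute ρ zero k)
         (cong (λ j → punchIn j (remove zero ρ ⟨$⟩ʳ k)) (sym (π≈ρ zero))))))

-- A permutation σ of Fin (suc n) is determined by σ(0) and the permutation
-- of Fin n left after deleting 0 and σ(0).  The enumeration serves only to
-- define sums over the symmetric group.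

permAt : ∀ n → Fin (n !) → Permutation′ n
permAt zero    _ = Perm.id
permAt (suc n) k = let (j , l) = remQuot (n !) k in insert zero j (permAt n l)

permIndex : ∀ n → Permutation′ n → Fin (n !)
permIndex zero    _ = zero
permIndex (suc n) σ = combine (σ ⟨$⟩ʳ zero) (permIndex n (remove zero σ))

permIndex-cong : ∀ n {σ τ} → σ Perm.≈ τ → permIndex n σ ≡ permIndex n τ
permIndex-cong zero    _   = refl
permIndex-cong (suc n) {σ} {τ} σ≈τ = cong₂ combine (σ≈τ zero)
  (permIndex-cong n (remove-cong {π = σ} {ρ = τ} σ≈τ))

permAt-permIndex : ∀ n σ → permAt n (permIndex n σ) Perm.≈ σ
permAt-permIndex (suc n) σ i = begin
  insert zero (proj₁ p) (permAt n (proj₂ p)) ⟨$⟩ʳ i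
    ≡⟨ cong (λ q → insert zero (proj₁ q) (permAt n (proj₂ q)) ⟨$⟩ʳ i)
            (remQuot-combine (σ ⟨$⟩ʳ zero) (permIndex n σ′)) ⟩
  insert zero (σ ⟨$⟩ʳ zero) (permAt n (permIndex n σ′)) ⟨$⟩ʳ i
    ≡⟨ insert-cong (σ ⟨$⟩ʳ zero)
         {π = permAt n (permIndex n σ′)} {ρ = σ′} (permAt-permIndex n σ′) i ⟩
  insert zero (σ ⟨$⟩ʳ zero) σ′ ⟨$⟩ʳ i
    ≡⟨ insert-remove zero σ i ⟩
  σ ⟨$⟩ʳ i ∎
  where
  open ≡-Reasoning
  σ′ = remove zero σ
  p = remQuot {suc n} (n !) (permIndex (suc n) σ)

permIndex-permAt : ∀ n k → permIndex n (permAt n k) ≡ k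
permIndex-permAt zero    zero = refl
permIndex-permAt (suc n) k = begin
  combine j (permIndex n (remove zero (insert zero j (permAt n l))))
    ≡⟨ cong (combine j) (permIndex-cong n
         {σ = remove zero (insert zero j (permAt n l))} {τ = permAt n l}
         (remove-insert zero j (permAt n l))) ⟩
  combine j (permIndex n (permAt n l))
    ≡⟨ cong (combine j) (permIndex-permAt n l) ⟩
  combine j l
    ≡⟨ combine-remQuot {suc n} (n !) k ⟩
  k ∎
  where
  open ≡-Reasoning
  j = proj₁ (remQuot {suc n} (n !) k)
  l = proj₂ (remQuot {suc n} (n !) k)

Sym-enumeration : ∀ n → Inverse (≡.setoid (Fin (n !))) (Sym n)
Sym-enumeration n = record
  { to        = permAt n
  ; from      = permIndex n
  ; to-cong   = λ { refl _ → refl }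
  ; from-cong = λ {σ} {τ} → permIndex-cong n {σ} {τ}
  ; inverse   = (λ { {σ} refl → permAt-permIndex n σ })
              , (λ {k} {σ} σ≈ → trans (permIndex-cong n {σ} {permAt n k} σ≈)
                                      (permIndex-permAt n k))
  }

-- The space ℝ^{S_n}: functions respecting equality of permutations.

Fun : ℕ → Set
Fun n = Func (Sym n) ℝ-setoid

infixl 9 _$$_
_$$_ : ∀ {n} → Fun n → Permutation′ n → ℝ
_$$_ = Func.to

infixl 6 _-ᶠ_
_-ᶠ_ : ∀ {n} → Fun n → Fun n → Fun n
f -ᶠ g = record
  { to   = λ σ → f $$ σ -ℝ g $$ σ
  ; cong = λ σ≈τ → +ℝ-cong (Func.cong f σ≈τ) (-ℝ-cong (Func.cong g σ≈τ))
  }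

sumSym : ∀ {n} → (Permutation′ n → ℝ) → ℝ
sumSym {n} h = ∑[ k < n ! ] h (Inverse.to (Sym-enumeration n) k)

⟨_,_⟩ : ∀ {n} → Fun n → Fun n → ℝ
⟨ f , g ⟩ = sumSym (λ σ → (f $$ σ) *ℝ (g $$ σ))

_⊥ : ∀ {n} → Pred (Fun n) 0ℓ → Pred (Fun n) 0ℓ
(W ⊥) f = ∀ g → g ∈ W → ⟨ f , g ⟩ ≈ℝ 0ℝ

Span : ∀ {n} {I : Set} → (I → Fun n) → Pred (Fun n) 0ℓ
Span {n} {I} v f = ∃[ m ] Σ (Fin m → ℝ) λ c → Σ (Fin m → I) λ ι →
  ∀ σ → f $$ σ ≈ℝ ∑[ k < m ] (c k *ℝ (v (ι k) $$ σ))

indicator : Bool → ℝ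
indicator b = if b then 1ℝ else 0ℝ

indicatorFun : ∀ {n} → Func (Sym n) (≡.setoid Bool) → Fun n
indicatorFun P = record
  { to   = λ σ → indicator (Func.to P σ)
  ; cong = λ σ≈τ → Setoid.reflexive ℝ-setoid (cong indicator (Func.cong P σ≈τ))
  }

x : ∀ {n} → Fin n → Fin n → Fun n
x i j = indicatorFun record
  { to   = λ σ → does (σ ⟨$⟩ʳ i ≟ j)
  ; cong = λ σ≈τ → cong (λ k → does (k ≟ j)) (σ≈τ i)
  }

U : ∀ n → Pred (Fun n) 0ℓ
U n = Span {I = Fin n × Fin n} (uncurry x)

-- A subset of the symmetric group is given by its characteristic function.
-- The bijection with Fin n says that it has n elements.

record OneFactorization (n : ℕ) : Set where
  field
    characteristic : Func (Sym n) (≡.setoid Bool)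

  Member : Permutation′ n → Set
  Member σ = Func.to characteristic σ ≡ true

  elements : Setoid 0ℓ 0ℓ
  elements = On.setoid {B = ∃ Member} (Sym n) proj₁

  field
    enumeration : Inverse (≡.setoid (Fin n)) elements
    disjoint    : ∀ σ τ → Member σ → Member τ → ¬ (σ Perm.≈ τ) → Disjoint σ τ

  element : Fin n → Permutation′ n
  element k = proj₁ (Inverse.to enumeration k)

sumOver : ∀ {n} → OneFactorization n → (Permutation′ n → ℝ) → ℝ
sumOver {n} L h = ∑[ k < n ] h (OneFactorization.element L k)

v : ∀ {n} → OneFactorization n → Fun n
v L = indicatorFun (OneFactorization.characteristic L)

T : ∀ n → Pred (Fun n) 0ℓ
T n = Span {I = OneFactorization n × OneFactorization n} (λ (L , L′) → v L -ᶠ v L′)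

{-# OPTIONS --safe #-}
module Submission where

open import Algebra.Bundles using (AbelianGroup; CommutativeMonoid; CommutativeRing)
import Algebra.Properties.AbelianGroup as AbelianGroupProperties
import Algebra.Properties.CommutativeMonoid.Sum as CommutativeMonoidSum
import Algebra.Properties.CommutativeSemigroup as CommutativeSemigroupProperties
import Algebra.Properties.Ring as RingProperties
import Algebra.Properties.Semiring.Sum as SemiringSum
import Algebra.Solver.CommutativeMonoid as CommutativeMonoidSolver
open import Data.Bool.Base using (Bool; true; false; if_then_else_; _∧_; _∨_; not)
open import Data.Bool.Properties using (∨-zeroʳ) renaming (_≟_ to _≟ᵇ_)
import Data.Empty as Empty
open import Data.Fin.Base
  using (Fin; zero; suc; toℕ; fromℕ; inject₁; punchIn; punchOut; combine; remQuot; _↑ˡ_; _↑ʳ_)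
open import Data.Fin.Patterns using (0F; 1F; 2F; 3F; 4F)
open import Data.Fin.Permutation as Perm
  using (Permutation′; _⟨$⟩ʳ_; _⟨$⟩ˡ_; _∘ₚ_; transpose; lift₀; insert)
import Data.Fin.Permutation.Components as PC
open import Data.Fin.Properties
  using (_≟_; any?; all?; injective⇒≤; punchOut-injective; suc-injective; toℕ-injective; toℕ<n; remQuot-combine)
open import Data.List.Base using (List; []; _∷_)
open import Data.Nat.Base as ℕ using (ℕ; zero; suc; _≤_; _<_; z≤n; s≤s; z<s; _!)
open import Data.Nat.Induction using (<-wellFounded)
import Data.Nat.Properties as ℕ
open import Data.Product.Base using (Σ-syntax; ∃-syntax; _×_; _,_; proj₁; proj₂; uncurry)
open import Data.Rational.Base using (½)
open import Data.Sum.Base using (_⊎_; inj₁; inj₂)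
open import Data.Vec.Functional using () renaming ([] to []ᵛ; _∷_ to _∷ᵛ_)
open import Function.Base using (_∘_; id)
open import Function.Bundles using (Func; Inverse; _⇔_; mk⇔)
open import Function.Definitions using (Injective)
open import Induction.WellFounded using (Acc; acc)
open import Level using (0ℓ)
open import Relation.Binary.PropositionalEquality as ≡
  using (_≡_; _≢_; _≗_; cong; cong₂; subst; ≢-sym)
open import Relation.Nullary using (¬_; Dec; yes; no; does; contradiction)
open import Relation.Nullary.Decidable
  using (True; toWitness; dec-true; dec-false; decidable-stable; does-⇔; from-yes; ¬?; _→-dec_; _×-dec_)
open import Relation.Unary using (_∈_; _≐_)
open import Defs using (Disjoint)

-- Two disjoint permutations extend to a one-factorization (Hall's theorem,
-- applied to regular bipartite graphs), and exchanging their values on a union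
-- of cycles of one relative to the other gives another one.  Hence, if the sums
-- of f over one-factorizations agree, f(σ) − f(σ ∘ (i j)) does not change when σ
-- is replaced by a permutation with the same values at i and j and different
-- values elsewhere.  For n ≠ 5 such steps connect any two permutations with the
-- same values at i and j; for n = 5 they preserve the sign, and two explicit
-- Latin squares dispose of it.  So f(σ) − f(σ ∘ (0 i)) depends only on σ(0) and
-- σ(i).  The alternating sum of f over the permutations of three positions
-- vanishes, so this dependence splits as pᵢ(σ(i)) − pᵢ(σ(0)), and then
-- f(σ) − ∑ᵢ pᵢ(σ(i)) is invariant under all (0 i), hence constant.

-- The identities for `f` hold in any abelian group without 2-torsion. Halving is needed twice: for
-- n = 5, and for the alternating sum over three of four positions. All case distinctions are on
-- permutations and positions, never on reals, whose equality is not decidable. Composition with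
-- fixed permutations on both sides preserves disjointness, so an identity need only be shown for
-- one choice of positions at the identity permutation. For n = 5 the steps preserve the sign
-- because a derangement of the three remaining positions is a 3-cycle. What they leave undetermined
-- follows the sign, and squares with different numbers of odd rows detect it. The splitting is a
-- cocycle argument. Let D(a, b) be f(σ ∘ (0 i)) - f(σ) for σ(0) = a and σ(i) = b. The alternating
-- sum over the positions 0, i, r gives D(a, b) = D(a, c) - D(b, c) with c = σ(r); taking c to be
-- the value i yields pᵢ(a) = D(a, i).

private variable
  k m n : ℕ

-- Permutations

⟨$⟩ʳ-injective : ∀ (π : Permutation′ n) {i j} → π ⟨$⟩ʳ i ≡ π ⟨$⟩ʳ j → i ≡ j
⟨$⟩ʳ-injective π {i} {j} eq = begin
  i                    ≡⟨ Perm.inverseˡ π ⟨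
  π ⟨$⟩ˡ (π ⟨$⟩ʳ i)    ≡⟨ cong (π ⟨$⟩ˡ_) eq ⟩
  π ⟨$⟩ˡ (π ⟨$⟩ʳ j)    ≡⟨ Perm.inverseˡ π ⟩
  j                    ∎
  where open ≡.≡-Reasoning

-- If `y` were missed, punching it out would inject `Fin (suc n)` into `Fin n`.
injective⇒surjective : ∀ {f : Fin n → Fin n} → Injective _≡_ _≡_ f → ∀ y → ∃[ i ] f i ≡ y
injective⇒surjective {suc n} {f} f-inj y with any? (λ i → f i ≟ y)
... | yes found = found
... | no ¬found = contradiction (injective⇒≤ punch-injective) ℕ.1+n≰n
  where
  missed : ∀ i → y ≢ f i
  missed i eq = ¬found (i , ≡.sym eq)
  punch-injective : Injective _≡_ _≡_ (λ i → punchOut (missed i))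
  punch-injective {i} {j} eq = f-inj (punchOut-injective (missed i) (missed j) eq)

injective⇒permutation : ∀ (f : Fin n → Fin n) → Injective _≡_ _≡_ f →
  Σ[ π ∈ Permutation′ n ] (∀ i → π ⟨$⟩ʳ i ≡ f i)
injective⇒permutation f f-inj =
  Perm.permutation f (proj₁ ∘ f⁻¹) (proj₂ ∘ f⁻¹) (λ i → f-inj (proj₂ (f⁻¹ (f i)))) , λ _ → ≡.refl
  where
  f⁻¹ = injective⇒surjective f-inj

transpose-matchˡ : ∀ (i j : Fin n) → PC.transpose i j i ≡ j
transpose-matchˡ i j rewrite dec-true (i ≟ i) ≡.refl = ≡.refl

transpose-matchʳ : ∀ (i j : Fin n) → PC.transpose i j j ≡ i
transpose-matchʳ i j with j ≟ i
... | yes j≡i = j≡i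
... | no  _ rewrite dec-true (j ≟ j) ≡.refl = ≡.refl

transpose-mismatch : ∀ {i j l : Fin n} → l ≢ i → l ≢ j → PC.transpose i j l ≡ l
transpose-mismatch {i = i} {j} {l} l≢i l≢j
  rewrite dec-false (l ≟ i) l≢i | dec-false (l ≟ j) l≢j = ≡.refl

transpose-conjugate : ∀ (π : Permutation′ n) i j →
  Perm.flip π ∘ₚ transpose i j ∘ₚ π Perm.≈ transpose (π ⟨$⟩ʳ i) (π ⟨$⟩ʳ j)
transpose-conjugate π i j l with l ≟ π ⟨$⟩ʳ i
... | yes ≡.refl = cong (π ⟨$⟩ʳ_) (≡.trans (cong (PC.transpose i j) (Perm.inverseˡ π)) (transpose-matchˡ i j))
... | no l≢πi with l ≟ π ⟨$⟩ʳ j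
...   | yes ≡.refl = cong (π ⟨$⟩ʳ_) (≡.trans (cong (PC.transpose i j) (Perm.inverseˡ π)) (transpose-matchʳ i j))
...   | no l≢πj = ≡.trans
  (cong (π ⟨$⟩ʳ_) (transpose-mismatch {l = π ⟨$⟩ˡ l}
    (λ eq → l≢πi (≡.trans (≡.sym (Perm.inverseʳ π)) (cong (π ⟨$⟩ʳ_) eq)))
    (λ eq → l≢πj (≡.trans (≡.sym (Perm.inverseʳ π)) (cong (π ⟨$⟩ʳ_) eq)))))
  (Perm.inverseʳ π)

-- Once `π` is right on the tail, it is precomposed with the transposition of `a zero` and the
-- position `c` where `π` takes the value `b zero`. Injectivity of `a` and `b` keeps the tail away
-- from both.
extend-injection : ∀ (a b : Fin k → Fin n) → Injective _≡_ _≡_ a → Injective _≡_ _≡_ b →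
  Σ[ π ∈ Permutation′ n ] (∀ l → π ⟨$⟩ʳ a l ≡ b l)
extend-injection {zero}  a b _     _     = Perm.id , λ ()
extend-injection {suc k} a b a-inj b-inj
  with extend-injection (a ∘ suc) (b ∘ suc) (suc-injective ∘ a-inj) (suc-injective ∘ b-inj)
... | π , πa≡b = transpose (a zero) c ∘ₚ π , matches
  where
  c = π ⟨$⟩ˡ b zero
  matches : ∀ l → transpose (a zero) c ∘ₚ π ⟨$⟩ʳ a l ≡ b l
  matches zero    = ≡.trans (cong (π ⟨$⟩ʳ_) (transpose-matchˡ (a zero) c)) (Perm.inverseʳ π)
  matches (suc l) = ≡.trans (cong (π ⟨$⟩ʳ_) (transpose-mismatch
    (λ eq → contradiction (a-inj eq) λ ())
    (λ eq → contradiction (b-inj (≡.trans (≡.sym (πa≡b l)) (≡.trans (cong (π ⟨$⟩ʳ_) eq) (Perm.inverseʳ π)))) λ ())))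
    (πa≡b l)

injective-∷ : ∀ {i : Fin n} {b : Fin k → Fin n} → (∀ l → i ≢ b l) → Injective _≡_ _≡_ b →
  Injective _≡_ _≡_ (i ∷ᵛ b)
injective-∷ i∉b b-inj {zero}  {zero}  _  = ≡.refl
injective-∷ i∉b b-inj {zero}  {suc l} eq = contradiction eq (i∉b l)
injective-∷ i∉b b-inj {suc j} {zero}  eq = contradiction (≡.sym eq) (i∉b j)
injective-∷ i∉b b-inj {suc j} {suc l} eq = cong suc (b-inj eq)

position : ∀ (i j l : Fin n) → l ≡ i ⊎ l ≡ j ⊎ (l ≢ i × l ≢ j)
position i j l with l ≟ i | l ≟ j
... | yes l≡i | _       = inj₁ l≡i
... | no _    | yes l≡j = inj₂ (inj₁ l≡j)
... | no l≢i  | no l≢j  = inj₂ (inj₂ (l≢i , l≢j))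

distinct₃ : ∀ {i j l : Fin n} → i ≢ j → i ≢ l → j ≢ l →
  Injective _≡_ _≡_ (i ∷ᵛ j ∷ᵛ l ∷ᵛ []ᵛ)
distinct₃ {i = i} {j} {l} i≢j i≢l j≢l =
  injective-∷ {b = j ∷ᵛ l ∷ᵛ []ᵛ} (λ { 0F → i≢j ; 1F → i≢l })
    (injective-∷ {b = l ∷ᵛ []ᵛ} (λ { 0F → j≢l }) (injective-∷ {b = []ᵛ} (λ ()) λ { {()} }))

distinct₄ : ∀ {h i j l : Fin n} → h ≢ i → h ≢ j → h ≢ l → i ≢ j → i ≢ l → j ≢ l →
  Injective _≡_ _≡_ (h ∷ᵛ i ∷ᵛ j ∷ᵛ l ∷ᵛ []ᵛ)
distinct₄ {i = i} {j} {l} h≢i h≢j h≢l i≢j i≢l j≢l =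
  injective-∷ {b = i ∷ᵛ j ∷ᵛ l ∷ᵛ []ᵛ} (λ { 0F → h≢i ; 1F → h≢j ; 2F → h≢l }) (distinct₃ i≢j i≢l j≢l)

transpose-comm : ∀ (i j : Fin n) → PC.transpose i j ≗ PC.transpose j i
transpose-comm i j l with position i j l
... | inj₁ ≡.refl             = ≡.trans (transpose-matchˡ l j) (≡.sym (transpose-matchʳ j l))
... | inj₂ (inj₁ ≡.refl)      = ≡.trans (transpose-matchʳ i l) (≡.sym (transpose-matchˡ l i))
... | inj₂ (inj₂ (l≢i , l≢j)) = ≡.trans (transpose-mismatch l≢i l≢j) (≡.sym (transpose-mismatch l≢j l≢i))

-- Words of transpositions acting on positions

swap : Fin n → Fin n → Permutation′ n → Permutation′ n
swap i j σ = transpose i j ∘ₚ σ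

-- Keeping the word apart from the labelling `b` of positions lets identities be decided in the
-- symmetric group of the k labels, whatever n is.
Word : ℕ → Set
Word k = List (Fin k × Fin k)

act : (Fin k → Fin n) → Word k → Permutation′ n → Permutation′ n
act b []            σ = σ
act b ((i , j) ∷ w) σ = swap (b i) (b j) (act b w σ)

-- Renaming labels is conjugation by `π`. Thus a relation at the labels `a` and the identity
-- permutation transfers to the labels `b` and any `σ`.
act-conjugate : ∀ (π : Permutation′ n) {a b : Fin k → Fin n} → (∀ l → π ⟨$⟩ʳ a l ≡ b l) →
  ∀ w σ → Perm.flip π ∘ₚ act a w Perm.id ∘ₚ π ∘ₚ σ Perm.≈ act b w σ
act-conjugate π πa≡b []            σ l = cong (σ ⟨$⟩ʳ_) (Perm.inverseʳ π)
act-conjugate π {a} {b} πa≡b ((i , j) ∷ w) σ l = begin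
  E (t (π ⟨$⟩ˡ l))                                   ≡⟨ cong E (Perm.inverseˡ π) ⟨
  E (π ⟨$⟩ˡ (π ⟨$⟩ʳ t (π ⟨$⟩ˡ l)))                   ≡⟨ act-conjugate π πa≡b w σ (π ⟨$⟩ʳ t (π ⟨$⟩ˡ l)) ⟩
  act b w σ ⟨$⟩ʳ (π ⟨$⟩ʳ t (π ⟨$⟩ˡ l))               ≡⟨ cong (act b w σ ⟨$⟩ʳ_) (transpose-conjugate π (a i) (a j) l) ⟩
  act b w σ ⟨$⟩ʳ PC.transpose (π ⟨$⟩ʳ a i) (π ⟨$⟩ʳ a j) l
    ≡⟨ ≡.cong₂ (λ p q → act b w σ ⟨$⟩ʳ PC.transpose p q l) (πa≡b i) (πa≡b j) ⟩
  act b w σ ⟨$⟩ʳ PC.transpose (b i) (b j) l          ∎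
  where
  open ≡.≡-Reasoning
  t = PC.transpose (a i) (a j)
  E : Fin _ → Fin _
  E y = σ ⟨$⟩ʳ (π ⟨$⟩ʳ (act a w Perm.id ⟨$⟩ʳ y))

transpose-image : ∀ {b : Fin k → Fin n} → Injective _≡_ _≡_ b → ∀ i j l →
  PC.transpose (b i) (b j) (b l) ≡ b (PC.transpose i j l)
transpose-image {b = b} b-inj i j l with position i j l
... | inj₁ ≡.refl        = ≡.trans (transpose-matchˡ (b l) (b j)) (≡.sym (cong b (transpose-matchˡ l j)))
... | inj₂ (inj₁ ≡.refl) = ≡.trans (transpose-matchʳ (b i) (b l)) (≡.sym (cong b (transpose-matchʳ i l)))
... | inj₂ (inj₂ (l≢i , l≢j)) = ≡.trans (transpose-mismatch (l≢i ∘ b-inj) (l≢j ∘ b-inj))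
  (≡.sym (cong b (transpose-mismatch l≢i l≢j)))

missed-by : k < n → ∀ (b : Fin k → Fin n) → ∃[ l ] (∀ i → l ≢ b i)
missed-by k<n b with any? (λ l → all? λ i → ¬? (l ≟ b i))
... | yes found = found
... | no ¬found = contradiction (injective⇒≤ index-inj) (ℕ.<⇒≱ k<n)
  where
  index : ∀ l → ∃[ i ] l ≡ b i
  index l = decidable-stable (any? λ i → l ≟ b i) λ none → ¬found (l , λ i eq → none (i , eq))
  index-inj : Injective _≡_ _≡_ (proj₁ ∘ index)
  index-inj {l} {m} eq = ≡.trans (proj₂ (index l)) (≡.trans (cong b eq) (≡.sym (proj₂ (index m))))

eval : Word k → Permutation′ k
eval w = act id w Perm.id

act-image : ∀ {b : Fin k → Fin n} → Injective _≡_ _≡_ b → ∀ w σ l →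
  act b w σ ⟨$⟩ʳ b l ≡ σ ⟨$⟩ʳ b (eval w ⟨$⟩ʳ l)
act-image b-inj []            σ l = ≡.refl
act-image {b = b} b-inj ((i , j) ∷ w) σ l = ≡.trans
  (cong (act b w σ ⟨$⟩ʳ_) (transpose-image b-inj i j l))
  (act-image b-inj w σ (PC.transpose i j l))

act-∉image : ∀ {b : Fin k → Fin n} {x} → (∀ l → x ≢ b l) → ∀ w σ → act b w σ ⟨$⟩ʳ x ≡ σ ⟨$⟩ʳ x
act-∉image x∉b []            σ = ≡.refl
act-∉image {b = b} x∉b ((i , j) ∷ w) σ = ≡.trans
  (cong (act b w σ ⟨$⟩ʳ_) (transpose-mismatch (x∉b i) (x∉b j)))
  (act-∉image x∉b w σ)

-- A word moves the image of `b` as its value moves the labels, and nothing else. It is applied to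
-- words on three or four labels, where the hypothesis is settled by evaluation.
act-cong : ∀ {b : Fin k → Fin n} → Injective _≡_ _≡_ b → ∀ w w′ → eval w Perm.≈ eval w′ →
  ∀ σ → act b w σ Perm.≈ act b w′ σ
act-cong {b = b} b-inj w w′ w≈w′ σ x with any? (λ l → x ≟ b l)
... | yes (l , ≡.refl) = ≡.trans (act-image b-inj w σ l)
  (≡.trans (cong (λ y → σ ⟨$⟩ʳ b y) (w≈w′ l)) (≡.sym (act-image b-inj w′ σ l)))
... | no x∉b = ≡.trans (act-∉image (λ l eq → x∉b (l , eq)) w σ)
  (≡.sym (act-∉image (λ l eq → x∉b (l , eq)) w′ σ))

_≈?_ : (α β : Permutation′ n) → Dec (∀ l → α ⟨$⟩ʳ l ≡ β ⟨$⟩ʳ l)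
α ≈? β = all? λ l → α ⟨$⟩ʳ l ≟ β ⟨$⟩ʳ l

-- The cycle sending 0 to the last element and every other element to its predecessor: a derangement
-- in every size from two on.
rotation : ∀ n → Permutation′ (suc n)
rotation n = insert zero (fromℕ n) Perm.id

rotation-suc : ∀ n l → rotation n ⟨$⟩ʳ suc l ≡ punchIn (fromℕ n) l
rotation-suc n = Perm.insert-punchIn zero (fromℕ n) Perm.id

rotation-deranges : ∀ n l → rotation (suc n) ⟨$⟩ʳ l ≢ l
rotation-deranges n zero    = λ ()
rotation-deranges n (suc l) eq = punchIn≢suc (≡.trans (≡.sym (rotation-suc (suc n) l)) eq)
  where
  punchIn≢suc : ∀ {n} {l : Fin n} → punchIn (fromℕ n) l ≢ suc l
  punchIn≢suc {l = zero}  ()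
  punchIn≢suc {l = suc l} eq = punchIn≢suc (suc-injective eq)

module _ (M : CommutativeMonoid 0ℓ 0ℓ) where

  open CommutativeMonoid M
  open CommutativeMonoidSum M using (sum; sum-replicate-zero)

  -- Serves both cardinalities in ℕ and sums of reals, hence the arbitrary monoid.
  ∑-point : ∀ (h : Fin n → Carrier) i → sum (λ l → if does (i ≟ l) then h l else ε) ≈ h i
  ∑-point {suc n} h zero    = trans (∙-congˡ (sum-replicate-zero n)) (identityʳ (h zero))
  ∑-point {suc n} h (suc i) = trans (identityˡ _) (∑-point (h ∘ suc) i)

-- Regular bipartite graphs

module RegularGraph where

  open ≡ using (refl; sym; trans; module ≡-Reasoning)
  open import Data.Nat.Base using (_+_; _*_; NonZero)

  module ℕ∑ = SemiringSum ℕ.+-*-semiring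
  open ℕ∑ using (sum; *-distribˡ-sum; sum-cong-≗; ∑-distrib-+; ∑-comm)

  sum-mono-≤ : ∀ {g h : Fin n → ℕ} → (∀ i → g i ≤ h i) → sum g ≤ sum h
  sum-mono-≤ {zero}  g≤h = z≤n
  sum-mono-≤ {suc n} g≤h = ℕ.+-mono-≤ (g≤h zero) (sum-mono-≤ (g≤h ∘ suc))

  sum-mono-< : ∀ {g h : Fin n → ℕ} → (∀ i → g i ≤ h i) → ∀ i → g i < h i → sum g < sum h
  sum-mono-< g≤h zero    g<h = ℕ.+-mono-<-≤ g<h (sum-mono-≤ (g≤h ∘ suc))
  sum-mono-< g≤h (suc i) g<h = ℕ.+-mono-≤-< (g≤h zero) (sum-mono-< (g≤h ∘ suc) i g<h)

  FinSet : ℕ → Set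
  FinSet n = Fin n → Bool

  bit : Bool → ℕ
  bit b = if b then 1 else 0

  card : FinSet n → ℕ
  card P = sum (bit ∘ P)

  singleton : Fin n → FinSet n
  singleton i l = does (i ≟ l)

  remove : FinSet n → Fin n → FinSet n
  remove P i l = P l ∧ not (singleton i l)

  card-singleton : ∀ (i : Fin n) → card (singleton i) ≡ 1
  card-singleton = ∑-point ℕ.+-0-commutativeMonoid (λ _ → 1)

  card-full : ∀ n → card {n} (λ _ → true) ≡ n
  card-full zero    = refl
  card-full (suc n) = cong suc (card-full n)

  card-∪-∩ : ∀ (P Q : FinSet n) → card (λ i → P i ∨ Q i) + card (λ i → P i ∧ Q i) ≡ card P + card Q
  card-∪-∩ P Q = begin
    card (λ i → P i ∨ Q i) + card (λ i → P i ∧ Q i)      ≡⟨ ∑-distrib-+ (λ i → bit (P i ∨ Q i)) _ ⟨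
    sum (λ i → bit (P i ∨ Q i) + bit (P i ∧ Q i))        ≡⟨ sum-cong-≗ (λ i → bits (P i) (Q i)) ⟩
    sum (λ i → bit (P i) + bit (Q i))                    ≡⟨ ∑-distrib-+ (bit ∘ P) _ ⟩
    card P + card Q                                      ∎
    where
    open ≡-Reasoning
    bits : ∀ a b → bit (a ∨ b) + bit (a ∧ b) ≡ bit a + bit b
    bits false b     = ℕ.+-identityʳ (bit b)
    bits true  false = refl
    bits true  true  = refl

  remove-⊆ : ∀ (P : FinSet n) i l → remove P i l ≡ true → P l ≡ true
  remove-⊆ P i l with P l
  ... | true  = λ _ → refl
  ... | false = λ ()

  remove-∌ : ∀ (P : FinSet n) i → remove P i i ≡ false
  remove-∌ P i rewrite dec-true (i ≟ i) refl with P i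
  ... | true  = refl
  ... | false = refl

  remove-≢ : ∀ (P : FinSet n) {i l} → i ≢ l → remove P i l ≡ P l
  remove-≢ P {i} {l} i≢l rewrite dec-false (i ≟ l) i≢l with P l
  ... | true  = refl
  ... | false = refl

  remove-true⇒≢ : ∀ (P : FinSet n) i {l} → remove P i l ≡ true → i ≢ l
  remove-true⇒≢ P i eq refl = contradiction (trans (sym eq) (remove-∌ P i)) λ ()

  card-remove : ∀ (P : FinSet n) {i} → P i ≡ true → card P ≡ suc (card (remove P i))
  card-remove P {i} Pi = begin
    card P                                                ≡⟨ sum-cong-≗ split ⟩
    sum (λ l → bit (singleton i l) + bit (remove P i l))  ≡⟨ ∑-distrib-+ (bit ∘ singleton i) _ ⟩
    card (singleton i) + card (remove P i)                ≡⟨ cong (_+ card (remove P i)) (card-singleton i) ⟩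
    suc (card (remove P i))                               ∎
    where
    open ≡-Reasoning
    split : ∀ l → bit (P l) ≡ bit (singleton i l) + bit (remove P i l)
    split l with i ≟ l
    ... | yes refl rewrite Pi = refl
    ... | no  _    with P l
    ...   | true  = refl
    ...   | false = refl

  -- Hall's theorem

  Graph : ℕ → Set
  Graph n = Fin n → FinSet n

  removeEdge : Graph n → Fin n → Fin n → Graph n
  removeEdge A i y l z = A l z ∧ not (singleton i l ∧ singleton y z)

  record Matching (A : Graph n) : Set where
    field
      partner   : Fin n → Fin n
      injective : Injective _≡_ _≡_ partner
      edge      : ∀ i → A i (partner i) ≡ true

  -- A violation of Hall's condition. `columns` may exceed the set of neighbours, which spares
  -- computing neighbourhoods of unions and intersections.
  record Obstruction (A : Graph n) : Set where
    field
      rows columns : FinSet n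
      neighbours   : ∀ i y → rows i ≡ true → A i y ≡ true → columns y ≡ true
      deficient    : card columns < card rows

  ∨-true : ∀ {a b} → a ∨ b ≡ true → a ≡ true ⊎ b ≡ true
  ∨-true {true}  _  = inj₁ refl
  ∨-true {false} eq = inj₂ eq

  ∧-true : ∀ {a b} → a ∧ b ≡ true → a ≡ true × b ≡ true
  ∧-true {true} eq = refl , eq

  ∨-introˡ : ∀ {a b} → a ≡ true → a ∨ b ≡ true
  ∨-introˡ refl = refl

  ∨-introʳ : ∀ {a b} → b ≡ true → a ∨ b ≡ true
  ∨-introʳ refl = ∨-zeroʳ _

  removeEdge-≢ : ∀ (A : Graph n) i y {l z} → A l z ≡ true → ¬ (i ≡ l × y ≡ z) →
    removeEdge A i y l z ≡ true
  removeEdge-≢ A i y {l} {z} Alz ≢ with i ≟ l | y ≟ z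
  ... | yes i≡l | yes y≡z = contradiction (i≡l , y≡z) ≢
  ... | yes _   | no  _   rewrite Alz = refl
  ... | no  _   | _       rewrite Alz = refl

  matching-removeEdge : ∀ (A : Graph n) i y → Matching (removeEdge A i y) → Matching A
  matching-removeEdge A i y M = record
    { partner   = partner
    ; injective = injective
    ; edge      = λ l → proj₁ (∧-true (edge l))
    }
    where open Matching M

  -- Rado's argument: if deleting either of two edges at the row i creates an
  -- obstruction, then A already has one, for the union or for the intersection
  -- less i of the two sets of rows, because cardinality is modular.

  obstruction-removeEdges : ∀ (A : Graph n) i {y z} → y ≢ z →
    Obstruction (removeEdge A i y) → Obstruction (removeEdge A i z) → Obstruction A
  obstruction-removeEdges A i {y} {z} y≢z O₁ O₂ with O₁.rows i in P₁i | O₂.rows i in P₂i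
    where
    module O₁ = Obstruction O₁
    module O₂ = Obstruction O₂
  -- Row `i` lies outside this obstruction, so the deleted edge is irrelevant to it.
  ... | false | _ = record
    { rows       = O₁.rows
    ; columns    = O₁.columns
    ; neighbours = λ l w Pl Alw → O₁.neighbours l w Pl
        (removeEdge-≢ A i y Alw λ { (refl , _) → contradiction (trans (sym Pl) P₁i) λ () })
    ; deficient  = O₁.deficient
    }
    where module O₁ = Obstruction O₁
  ... | true | false = record
    { rows       = O₂.rows
    ; columns    = O₂.columns
    ; neighbours = λ l w Pl Alw → O₂.neighbours l w Pl
        (removeEdge-≢ A i z Alw λ { (refl , _) → contradiction (trans (sym Pl) P₂i) λ () })
    ; deficient  = O₂.deficient
    }
    where module O₂ = Obstruction O₂
  ... | true | true with card (λ w → Q₁ w ∨ Q₂ w) ℕ.<? card (λ l → P₁ l ∨ P₂ l)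
    where
    open Obstruction O₁ renaming (rows to P₁; columns to Q₁)
    open Obstruction O₂ renaming (rows to P₂; columns to Q₂)
  ...   | yes fewer = record
    { rows       = λ l → P₁ l ∨ P₂ l
    ; columns    = λ w → Q₁ w ∨ Q₂ w
    ; neighbours = nbrs
    ; deficient  = fewer
    }
    where
    open Obstruction O₁ renaming (rows to P₁; columns to Q₁; neighbours to nbrs₁)
    open Obstruction O₂ renaming (rows to P₂; columns to Q₂; neighbours to nbrs₂)
    nbrs : ∀ l w → P₁ l ∨ P₂ l ≡ true → A l w ≡ true → Q₁ w ∨ Q₂ w ≡ true
    -- In row `i`, column `y` is covered by the second obstruction, whose graph keeps that edge, and
    -- every other column by the first.
    nbrs l w Pl Alw with i ≟ l
    ... | yes refl with y ≟ w
    ...   | yes refl = ∨-introʳ (nbrs₂ i w P₂i (removeEdge-≢ A i z Alw λ (_ , z≡y) → y≢z (sym z≡y)))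
    ...   | no  y≢w  = ∨-introˡ (nbrs₁ i w P₁i (removeEdge-≢ A i y Alw λ (_ , y≡w) → y≢w y≡w))
    nbrs l w Pl Alw | no i≢l with ∨-true {P₁ l} Pl
    ... | inj₁ P₁l = ∨-introˡ (nbrs₁ l w P₁l (removeEdge-≢ A i y Alw λ (i≡l , _) → i≢l i≡l))
    ... | inj₂ P₂l = ∨-introʳ (nbrs₂ l w P₂l (removeEdge-≢ A i z Alw λ (i≡l , _) → i≢l i≡l))
  ...   | no sufficient = record
    { rows       = remove (λ l → P₁ l ∧ P₂ l) i
    ; columns    = λ w → Q₁ w ∧ Q₂ w
    ; neighbours = nbrs
    ; deficient  = ℕ.≤-pred (subst (2 + card (λ w → Q₁ w ∧ Q₂ w) ≤_) (card-remove (λ l → P₁ l ∧ P₂ l) (cong₂ _∧_ P₁i P₂i))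
        (ℕ.+-cancelˡ-≤ (card (λ l → P₁ l ∨ P₂ l)) _ _ bound))
    }
    where
    open Obstruction O₁ renaming (rows to P₁; columns to Q₁; neighbours to nbrs₁; deficient to deficient₁)
    open Obstruction O₂ renaming (rows to P₂; columns to Q₂; neighbours to nbrs₂; deficient to deficient₂)
    nbrs : ∀ l w → remove (λ l → P₁ l ∧ P₂ l) i l ≡ true → A l w ≡ true → Q₁ w ∧ Q₂ w ≡ true
    nbrs l w Pl Alw with remove-true⇒≢ (λ l → P₁ l ∧ P₂ l) i Pl | ∧-true {P₁ l} (remove-⊆ (λ l → P₁ l ∧ P₂ l) i l Pl)
    ... | i≢l | P₁l , P₂l = cong₂ _∧_
      (nbrs₁ l w P₁l (removeEdge-≢ A i y Alw λ (i≡l , _) → i≢l i≡l))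
      (nbrs₂ l w P₂l (removeEdge-≢ A i z Alw λ (i≡l , _) → i≢l i≡l))
    open ℕ.≤-Reasoning
    -- The two deficiencies add up to a surplus of two rows. One pays for dropping `i`, whose edges
    -- to `y` and `z` the intersection need not cover.
    bound : card (λ l → P₁ l ∨ P₂ l) + suc (suc (card (λ w → Q₁ w ∧ Q₂ w)))
          ≤ card (λ l → P₁ l ∨ P₂ l) + card (λ l → P₁ l ∧ P₂ l)
    bound = begin
      card (λ l → P₁ l ∨ P₂ l) + suc (suc (card (λ w → Q₁ w ∧ Q₂ w)))
        ≤⟨ ℕ.+-monoˡ-≤ _ (ℕ.≮⇒≥ sufficient) ⟩
      card (λ w → Q₁ w ∨ Q₂ w) + suc (suc (card (λ w → Q₁ w ∧ Q₂ w)))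
        ≡⟨ trans (ℕ.+-suc _ _) (cong suc (ℕ.+-suc _ _)) ⟩
      suc (suc (card (λ w → Q₁ w ∨ Q₂ w) + card (λ w → Q₁ w ∧ Q₂ w)))
        ≡⟨ cong (2 +_) (card-∪-∩ Q₁ Q₂) ⟩
      suc (suc (card Q₁ + card Q₂))
        ≡⟨ cong suc (ℕ.+-suc _ _) ⟨
      suc (card Q₁) + suc (card Q₂)
        ≤⟨ ℕ.+-mono-≤ deficient₁ deficient₂ ⟩
      card P₁ + card P₂
        ≡⟨ card-∪-∩ P₁ P₂ ⟨
      card (λ l → P₁ l ∨ P₂ l) + card (λ l → P₁ l ∧ P₂ l) ∎

  edges : Graph n → ℕ
  edges A = sum (card ∘ A)

  edges-removeEdge : ∀ (A : Graph n) {i y} → A i y ≡ true → edges (removeEdge A i y) < edges A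
  edges-removeEdge A {i} {y} Aiy = sum-mono-< (λ l → sum-mono-≤ (fewer l)) i (sum-mono-< (fewer i) y fewer′)
    where
    fewer : ∀ l z → bit (removeEdge A i y l z) ≤ bit (A l z)
    fewer l z with A l z | not (singleton i l ∧ singleton y z)
    ... | false | _     = z≤n
    ... | true  | false = z≤n
    ... | true  | true  = ℕ.≤-refl
    fewer′ : bit (removeEdge A i y i y) < bit (A i y)
    fewer′ rewrite Aiy | dec-true (i ≟ i) refl | dec-true (y ≟ y) refl = z<s

  -- Induction on the number of edges. While some row has two edges, either can be deleted, and two
  -- obstructions combine into one. When no row has two, an isolated row or two rows with a common
  -- neighbour obstruct; otherwise the edges form a matching.
  hall : ∀ (A : Graph n) → Matching A ⊎ Obstruction A
  hall A = go A (<-wellFounded (edges A))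
    where
    functional : ∀ (A : Graph n) →
      ¬ (∃[ i ] ∃[ y ] ∃[ z ] (y ≢ z × A i y ≡ true × A i z ≡ true)) →
      (∀ i → ∃[ y ] A i y ≡ true) → Matching A ⊎ Obstruction A
    functional A ¬two s with any? (λ i → any? λ l → ¬? (i ≟ l) ×-dec proj₁ (s i) ≟ proj₁ (s l))
    ... | no injective = inj₁ record
      { partner   = proj₁ ∘ s
      ; injective = λ {i} {l} si≡sl → decidable-stable (i ≟ l) λ i≢l → injective (i , l , i≢l , si≡sl)
      ; edge      = proj₂ ∘ s
      }
    ... | yes (i , l , i≢l , si≡sl) = inj₂ record
      { rows       = rows
      ; columns    = singleton (proj₁ (s i))
      ; neighbours = nbrs
      ; deficient  = deficient
      }
      where
      unique : ∀ i {y} → A i y ≡ true → proj₁ (s i) ≡ y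
      unique i {y} Aiy = decidable-stable (_ ≟ y) λ ≢ → ¬two (i , _ , _ , ≢ , proj₂ (s i) , Aiy)
      rows : FinSet _
      rows j = singleton i j ∨ singleton l j
      nbrs : ∀ j y → rows j ≡ true → A j y ≡ true → singleton (proj₁ (s i)) y ≡ true
      nbrs j y rj Ajy with i ≟ j
      ... | yes refl = dec-true (_ ≟ y) (unique i Ajy)
      ... | no  _    with l ≟ j
      ...   | yes refl = dec-true (_ ≟ y) (trans si≡sl (unique l Ajy))
      deficient : card (singleton (proj₁ (s i))) < card rows
      deficient rewrite card-singleton (proj₁ (s i))
        | card-remove rows {i} (∨-introˡ (dec-true (i ≟ i) refl))
        | card-remove (remove rows i) {l} (trans (remove-≢ rows i≢l) (∨-introʳ (dec-true (l ≟ l) refl)))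
        = s≤s z<s
    go : ∀ (A : Graph n) → Acc _<_ (edges A) → Matching A ⊎ Obstruction A
    go {n} A (acc rec) with any? (λ i → any? λ y → any? λ z →
      ¬? (y ≟ z) ×-dec A i y ≟ᵇ true ×-dec A i z ≟ᵇ true)
    ... | yes (i , y , z , y≢z , Aiy , Aiz)
      with go (removeEdge A i y) (rec (edges-removeEdge A Aiy))
         | go (removeEdge A i z) (rec (edges-removeEdge A Aiz))
    ...   | inj₁ M  | _       = inj₁ (matching-removeEdge A i y M)
    ...   | inj₂ _  | inj₁ M  = inj₁ (matching-removeEdge A i z M)
    ...   | inj₂ O₁ | inj₂ O₂ = inj₂ (obstruction-removeEdges A i y≢z O₁ O₂)
    go {n} A (acc rec) | no ¬two with any? (λ i → ¬? (any? λ y → A i y ≟ᵇ true))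
    ... | yes (i , isolated) = inj₂ record
      { rows       = singleton i
      ; columns    = λ _ → false
      ; neighbours = nbrs
      ; deficient  = ℕ.≤-reflexive (trans (cong suc (ℕ∑.sum-replicate-zero n)) (sym (card-singleton i)))
      }
      where
      nbrs : ∀ l y → singleton i l ≡ true → A l y ≡ true → false ≡ true
      nbrs l y i≡l Aly with i ≟ l
      ... | yes refl = contradiction (y , Aly) isolated
    ... | no ¬isolated = functional A ¬two λ i →
      decidable-stable (any? λ y → A i y ≟ᵇ true) λ none → ¬isolated (i , none)

  -- Factorization of regular graphs

  record Regular (d : ℕ) (A : Graph n) : Set where
    field
      rowDegree    : ∀ i → card (A i) ≡ d
      columnDegree : ∀ y → card (λ i → A i y) ≡ d

  -- Double counting: the d edges at each of the `rows` all end in `columns`, each of which meets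
  -- only d edges.
  regular⇒¬obstruction : ∀ {d} .{{_ : NonZero d}} {A : Graph n} → Regular d A → ¬ Obstruction A
  regular⇒¬obstruction {d = d} {A = A} R O = ℕ.<⇒≱ deficient (ℕ.*-cancelˡ-≤ d (begin
    d * card rows                                      ≡⟨ *-distribˡ-sum d (bit ∘ rows) ⟩
    sum (λ i → d * bit (rows i))                       ≡⟨ sum-cong-≗ (λ i → trans (ℕ.*-comm d _) (weigh (rows i) (A i) (rowDegree i))) ⟩
    sum (λ i → sum λ y → bit (rows i ∧ A i y))         ≤⟨ sum-mono-≤ (λ i → sum-mono-≤ λ y → mono i y) ⟩
    sum (λ i → sum λ y → bit (columns y ∧ A i y))      ≡⟨ ∑-comm (λ i y → bit (columns y ∧ A i y)) ⟩
    sum (λ y → sum λ i → bit (columns y ∧ A i y))      ≡⟨ sum-cong-≗ (λ y → trans (ℕ.*-comm d _) (weigh (columns y) (λ i → A i y) (columnDegree y))) ⟨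
    sum (λ y → d * bit (columns y))                    ≡⟨ *-distribˡ-sum d (bit ∘ columns) ⟨
    d * card columns                                   ∎))
    where
    open Regular R
    open Obstruction O
    open ℕ.≤-Reasoning
    weigh : ∀ {n} b (P : FinSet n) → card P ≡ d → bit b * d ≡ sum (λ y → bit (b ∧ P y))
    weigh true  P eq = trans (ℕ.+-identityʳ d) (sym eq)
    weigh {n} false P eq = sym (ℕ∑.sum-replicate-zero n)
    mono : ∀ i y → bit (rows i ∧ A i y) ≤ bit (columns y ∧ A i y)
    mono i y with rows i in r | A i y in a
    ... | false | _     = z≤n
    ... | true  | false = z≤n
    ... | true  | true  rewrite neighbours i y r a = ℕ.≤-refl

  _∖_ : Graph n → Permutation′ n → Graph n
  (A ∖ π) i = remove (A i) (π ⟨$⟩ʳ i)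

  regular-∖ : ∀ {d} {A : Graph n} (π : Permutation′ n) → (∀ i → A i (π ⟨$⟩ʳ i) ≡ true) →
    Regular (suc d) A → Regular d (A ∖ π)
  regular-∖ {A = A} π π∈A R = record
    { rowDegree    = λ i → ℕ.suc-injective (trans (sym (card-remove (A i) (π∈A i))) (rowDegree i))
    ; columnDegree = λ y → ℕ.suc-injective (begin
        suc (card (λ i → (A ∖ π) i y))
          ≡⟨ cong suc (sum-cong-≗ λ i → cong (λ b → bit (A i y ∧ not b)) (does-⇔ (mk⇔
               (λ eq → trans (cong (π ⟨$⟩ˡ_) (sym eq)) (Perm.inverseˡ π))
               (λ eq → trans (cong (π ⟨$⟩ʳ_) (sym eq)) (Perm.inverseʳ π)))
               (π ⟨$⟩ʳ i ≟ y) (π ⟨$⟩ˡ y ≟ i))) ⟩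
        suc (card (remove (λ i → A i y) (π ⟨$⟩ˡ y)))
          ≡⟨ card-remove (λ i → A i y) (trans (cong (A _) (sym (Perm.inverseʳ π))) (π∈A (π ⟨$⟩ˡ y))) ⟨
        card (λ i → A i y)
          ≡⟨ columnDegree y ⟩
        suc _ ∎)
    }
    where
    open Regular R
    open ≡-Reasoning

  PairwiseDisjoint : (Fin k → Permutation′ n) → Set
  PairwiseDisjoint e = ∀ {i j} → i ≢ j → Disjoint (e i) (e j)

  pairwiseDisjoint-∷ : ∀ {σ : Permutation′ n} {e : Fin k → Permutation′ n} →
    (∀ i → Disjoint σ (e i)) → PairwiseDisjoint e → PairwiseDisjoint (σ ∷ᵛ e)
  pairwiseDisjoint-∷ σ-e e-e {zero}  {zero}  0≢0 = contradiction refl 0≢0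
  pairwiseDisjoint-∷ σ-e e-e {zero}  {suc j} _   = σ-e j
  pairwiseDisjoint-∷ σ-e e-e {suc i} {zero}  _   = λ l → ≢-sym (σ-e i l)
  pairwiseDisjoint-∷ σ-e e-e {suc i} {suc j} i≢j = e-e (i≢j ∘ cong suc)

  -- Regularity rules out an obstruction, so a perfect matching splits off and the degree drops by
  -- one. Later factors are disjoint from it because they live in what remains.
  factorize : ∀ d (A : Graph n) → Regular d A →
    Σ[ e ∈ (Fin d → Permutation′ n) ] PairwiseDisjoint e × (∀ k i → A i (e k ⟨$⟩ʳ i) ≡ true)
  factorize zero    A R = (λ ()) , (λ {}) , λ ()
  factorize (suc d) A R with hall A
  ... | inj₂ O = contradiction O (regular⇒¬obstruction R)
  ... | inj₁ M with injective⇒permutation (Matching.partner M) (Matching.injective M)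
  ...   | π , π≡partner with factorize d (A ∖ π) (regular-∖ π π∈A R)
    where
    π∈A : ∀ i → A i (π ⟨$⟩ʳ i) ≡ true
    π∈A i = trans (cong (A i) (π≡partner i)) (Matching.edge M i)
  ...     | e , e-disjoint , e∈A∖π = π ∷ᵛ e
    , pairwiseDisjoint-∷ (λ k i → remove-true⇒≢ (A i) (π ⟨$⟩ʳ i) (e∈A∖π k i)) e-disjoint
    , λ { zero    i → trans (cong (A i) (π≡partner i)) (Matching.edge M i)
        ; (suc k) i → remove-⊆ (A i) (π ⟨$⟩ʳ i) _ (e∈A∖π k i) }

  -- Removing two disjoint permutations from the complete graph on 2 + n rows leaves an n-regular
  -- graph, whose factors are the missing permutations.
  completion : ∀ {σ τ : Permutation′ (2 + n)} → Disjoint σ τ →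
    Σ[ e ∈ (Fin n → Permutation′ (2 + n)) ]
      PairwiseDisjoint e × (∀ k → Disjoint σ (e k)) × (∀ k → Disjoint τ (e k))
  completion {n} {σ} {τ} σ-τ with factorize n ((full ∖ σ) ∖ τ) (regular-∖ τ τ∈ (regular-∖ σ (λ _ → refl) full-regular))
    where
    full : Graph (2 + n)
    full _ _ = true
    full-regular : Regular (2 + n) full
    full-regular = record { rowDegree = λ _ → card-full (2 + n) ; columnDegree = λ _ → card-full (2 + n) }
    τ∈ : ∀ i → (full ∖ σ) i (τ ⟨$⟩ʳ i) ≡ true
    τ∈ i = remove-≢ (λ _ → true) (σ-τ i)
  ... | e , e-disjoint , e∈ = e , e-disjoint
    , (λ k i → remove-true⇒≢ (λ _ → true) (σ ⟨$⟩ʳ i) (remove-⊆ (remove (λ _ → true) (σ ⟨$⟩ʳ i)) (τ ⟨$⟩ʳ i) _ (e∈ k i)))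
    , (λ k i → remove-true⇒≢ (remove (λ _ → true) (σ ⟨$⟩ʳ i)) (τ ⟨$⟩ʳ i) (e∈ k i))

open RegularGraph using (PairwiseDisjoint; pairwiseDisjoint-∷; completion)

-- Functions with the same sum over all one-factorizations

-- With one letter per adjacent transposition, the parity of the length gives the sign.
adjacentSwaps : List (Fin 4) → Permutation′ 5
adjacentSwaps []      = Perm.id
adjacentSwaps (i ∷ w) = swap (inject₁ i) (suc i) (adjacentSwaps w)

-- The rows of two Latin squares as products of adjacent transpositions.  The
-- cyclic square has only even rows, the other one has a single odd row.
evenSquare oddSquare : Fin 5 → List (Fin 4)
evenSquare = []
  ∷ᵛ (3F ∷ 2F ∷ 1F ∷ 0F ∷ [])
  ∷ᵛ (2F ∷ 1F ∷ 0F ∷ 3F ∷ 2F ∷ 1F ∷ [])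
  ∷ᵛ (1F ∷ 0F ∷ 2F ∷ 1F ∷ 3F ∷ 2F ∷ [])
  ∷ᵛ (0F ∷ 1F ∷ 2F ∷ 3F ∷ [])
  ∷ᵛ []ᵛ
oddSquare = []
  ∷ᵛ (0F ∷ 3F ∷ 2F ∷ [])
  ∷ᵛ (2F ∷ 1F ∷ 0F ∷ 3F ∷ 2F ∷ 1F ∷ [])
  ∷ᵛ (1F ∷ 0F ∷ 2F ∷ 1F ∷ 3F ∷ 2F ∷ 1F ∷ 0F ∷ [])
  ∷ᵛ (0F ∷ 1F ∷ 0F ∷ 2F ∷ 1F ∷ 3F ∷ [])
  ∷ᵛ []ᵛ

pairwiseDisjoint? : (e : Fin k → Permutation′ n) →
  Dec (∀ i j → i ≢ j → Disjoint (e i) (e j))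
pairwiseDisjoint? e = all? λ i → all? λ j → ¬? (i ≟ j) →-dec all? λ l → ¬? (e i ⟨$⟩ʳ l ≟ e j ⟨$⟩ʳ l)

even-disjoint : PairwiseDisjoint (adjacentSwaps ∘ evenSquare)
even-disjoint {i} {j} = from-yes (pairwiseDisjoint? (adjacentSwaps ∘ evenSquare)) i j
odd-disjoint : PairwiseDisjoint (adjacentSwaps ∘ oddSquare)
odd-disjoint {i} {j} = from-yes (pairwiseDisjoint? (adjacentSwaps ∘ oddSquare)) i j

module Balance (G : AbelianGroup 0ℓ 0ℓ) where

  open AbelianGroup G renaming (_∙_ to _+_; ε to 0#; _⁻¹ to -_; ∙-cong to +-cong; ∙-congˡ to +-congˡ; ∙-congʳ to +-congʳ; comm to +-comm)
  open AbelianGroupProperties G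
  open CommutativeMonoidSum commutativeMonoid
  open CommutativeMonoidSolver commutativeMonoid using (solve; _⊕_; _⊜_)
  open import Relation.Binary.Reasoning.Setoid setoid

  -- Families indexed by `Fin n` stand in for one-factorizations, so that characteristic functions
  -- stay out of the combinatorics.
  record Balanced (f : Permutation′ n → Carrier) : Set where
    field
      congruent : ∀ σ τ → σ Perm.≈ τ → f σ ≈ f τ
      balanced  : ∀ (d e : Fin n → Permutation′ n) → PairwiseDisjoint d → PairwiseDisjoint e →
                  sum (f ∘ d) ≈ sum (f ∘ e)

  open Balanced

  translate : ∀ {f : Permutation′ n → Carrier} → Balanced f → ∀ α β →
    Balanced (λ σ → f (α ∘ₚ σ ∘ₚ β))
  congruent (translate F α β) σ τ σ≈τ = congruent F (α ∘ₚ σ ∘ₚ β) (α ∘ₚ τ ∘ₚ β) (λ l → cong (β ⟨$⟩ʳ_) (σ≈τ (α ⟨$⟩ʳ l)))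
  balanced  (translate F α β) d e d-disjoint e-disjoint = balanced F _ _ (moved d d-disjoint) (moved e e-disjoint)
    where
    moved : ∀ (d : Fin _ → Permutation′ _) → PairwiseDisjoint d → PairwiseDisjoint (λ i → α ∘ₚ d i ∘ₚ β)
    moved d d-disjoint i≢j l = d-disjoint i≢j (α ⟨$⟩ʳ l) ∘ ⟨$⟩ʳ-injective β

  balanced-+ : ∀ {f g : Permutation′ n → Carrier} → Balanced f → Balanced g → Balanced (λ σ → f σ + g σ)
  congruent (balanced-+ F G) σ τ σ≈τ = +-cong (congruent F σ τ σ≈τ) (congruent G σ τ σ≈τ)
  balanced  (balanced-+ {f = f} {g} F G) d e d-disjoint e-disjoint = begin
    sum (λ i → f (d i) + g (d i))    ≈⟨ ∑-distrib-+ (f ∘ d) (g ∘ d) ⟩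
    sum (f ∘ d) + sum (g ∘ d)        ≈⟨ +-cong (balanced F d e d-disjoint e-disjoint) (balanced G d e d-disjoint e-disjoint) ⟩
    sum (f ∘ e) + sum (g ∘ e)        ≈⟨ ∑-distrib-+ (f ∘ e) (g ∘ e) ⟨
    sum (λ i → f (e i) + g (e i))    ∎

  sum-neg : ∀ (h : Fin n → Carrier) → sum (λ i → - h i) ≈ - sum h
  sum-neg {zero}  h = sym ε⁻¹≈ε
  sum-neg {suc n} h = trans (+-congˡ (sum-neg (h ∘ suc))) (⁻¹-∙-comm _ _)

  balanced-neg : ∀ {f : Permutation′ n → Carrier} → Balanced f → Balanced (λ σ → - f σ)
  congruent (balanced-neg F) σ τ σ≈τ = ⁻¹-cong (congruent F σ τ σ≈τ)
  balanced  (balanced-neg {f = f} F) d e d-disjoint e-disjoint = begin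
    sum (λ i → - f (d i))    ≈⟨ sum-neg (f ∘ d) ⟩
    - sum (f ∘ d)            ≈⟨ ⁻¹-cong (balanced F d e d-disjoint e-disjoint) ⟩
    - sum (f ∘ e)            ≈⟨ sum-neg (f ∘ e) ⟨
    sum (λ i → - f (e i))    ∎

  -- At every position the new pair takes the same two values as the old one, so a completion of `σ`
  -- and `τ` also completes `σ′` and `τ′`, and its sum cancels.
  trade : ∀ {f : Permutation′ (2 ℕ.+ n) → Carrier} → Balanced f → ∀ σ τ σ′ τ′ → Disjoint σ τ →
    (∀ l → (σ′ ⟨$⟩ʳ l ≡ σ ⟨$⟩ʳ l × τ′ ⟨$⟩ʳ l ≡ τ ⟨$⟩ʳ l) ⊎ (σ′ ⟨$⟩ʳ l ≡ τ ⟨$⟩ʳ l × τ′ ⟨$⟩ʳ l ≡ σ ⟨$⟩ʳ l)) →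
    f σ + f τ ≈ f σ′ + f τ′
  trade {f = f} F σ τ σ′ τ′ σ-τ swapped with completion {σ = σ} {τ} σ-τ
  ... | e , e-disjoint , σ-e , τ-e = ∙-cancelʳ (sum (f ∘ e)) _ _ (begin
    (f σ + f τ) + sum (f ∘ e)     ≈⟨ assoc _ _ _ ⟩
    f σ + (f τ + sum (f ∘ e))     ≈⟨ balanced F (σ ∷ᵛ τ ∷ᵛ e) (σ′ ∷ᵛ τ′ ∷ᵛ e) (complete σ τ σ-τ σ-e τ-e) (complete σ′ τ′ σ′-τ′ σ′-e τ′-e) ⟩
    f σ′ + (f τ′ + sum (f ∘ e))   ≈⟨ assoc _ _ _ ⟨
    (f σ′ + f τ′) + sum (f ∘ e)   ∎)
    where
    complete : ∀ σ τ → Disjoint σ τ → (∀ i → Disjoint σ (e i)) → (∀ i → Disjoint τ (e i)) →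
      PairwiseDisjoint (σ ∷ᵛ τ ∷ᵛ e)
    complete σ τ σ-τ σ-e τ-e = pairwiseDisjoint-∷ {σ = σ} {τ ∷ᵛ e}
      (λ { zero → σ-τ ; (suc i) → σ-e i }) (pairwiseDisjoint-∷ {σ = τ} {e} τ-e e-disjoint)
    σ′-τ′ : Disjoint σ′ τ′
    σ′-τ′ l eq with swapped l
    ... | inj₁ (s , t) = σ-τ l (≡.trans (≡.sym s) (≡.trans eq t))
    ... | inj₂ (s , t) = σ-τ l (≡.trans (≡.sym t) (≡.trans (≡.sym eq) s))
    σ′-e : ∀ i → Disjoint σ′ (e i)
    σ′-e i l eq with swapped l
    ... | inj₁ (s , t) = σ-e i l (≡.trans (≡.sym s) eq)
    ... | inj₂ (s , t) = τ-e i l (≡.trans (≡.sym s) eq)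
    τ′-e : ∀ i → Disjoint τ′ (e i)
    τ′-e i l eq with swapped l
    ... | inj₁ (s , t) = τ-e i l (≡.trans (≡.sym t) eq)
    ... | inj₂ (s , t) = σ-e i l (≡.trans (≡.sym t) eq)

  -- σ and ρ ∘ (i j) are disjoint, and exchanging their values at i and j gives
  -- σ ∘ (i j) and ρ.
  swap-difference : ∀ {f : Permutation′ n → Carrier} → Balanced f → ∀ {i j} → i ≢ j → ∀ σ ρ →
    σ ⟨$⟩ʳ i ≡ ρ ⟨$⟩ʳ i → σ ⟨$⟩ʳ j ≡ ρ ⟨$⟩ʳ j → (∀ l → l ≢ i → l ≢ j → σ ⟨$⟩ʳ l ≢ ρ ⟨$⟩ʳ l) →
    f σ + f (swap i j ρ) ≈ f (swap i j σ) + f ρ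
  swap-difference {n = suc zero} F {zero} {zero} i≢j = contradiction ≡.refl i≢j
  swap-difference {n = suc (suc n)} F {i} {j} i≢j σ ρ σi σj σ≢ρ =
    trade F σ (swap i j ρ) (swap i j σ) ρ disjoint swapped
    where
    disjoint : Disjoint σ (swap i j ρ)
    disjoint l eq with position i j l
    ... | inj₁ ≡.refl = i≢j (⟨$⟩ʳ-injective ρ (≡.trans (≡.sym σi)
      (≡.trans eq (cong (ρ ⟨$⟩ʳ_) (transpose-matchˡ i j)))))
    ... | inj₂ (inj₁ ≡.refl) = i≢j (⟨$⟩ʳ-injective ρ (≡.sym (≡.trans (≡.sym σj)
      (≡.trans eq (cong (ρ ⟨$⟩ʳ_) (transpose-matchʳ i j))))))
    ... | inj₂ (inj₂ (l≢i , l≢j)) = σ≢ρ l l≢i l≢j (≡.trans eq (cong (ρ ⟨$⟩ʳ_) (transpose-mismatch l≢i l≢j)))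
    swapped : ∀ l → (swap i j σ ⟨$⟩ʳ l ≡ σ ⟨$⟩ʳ l × ρ ⟨$⟩ʳ l ≡ swap i j ρ ⟨$⟩ʳ l)
                  ⊎ (swap i j σ ⟨$⟩ʳ l ≡ swap i j ρ ⟨$⟩ʳ l × ρ ⟨$⟩ʳ l ≡ σ ⟨$⟩ʳ l)
    swapped l with position i j l
    ... | inj₁ ≡.refl rewrite transpose-matchˡ i j = inj₂ (σj , ≡.sym σi)
    ... | inj₂ (inj₁ ≡.refl) rewrite transpose-matchʳ i j = inj₂ (σi , ≡.sym σj)
    ... | inj₂ (inj₂ (l≢i , l≢j)) rewrite transpose-mismatch l≢i l≢j = inj₁ (≡.refl , ≡.refl)

  -- Vanishing of the mixed second difference of `f` along two transpositions: the difference along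
  -- either one is unchanged by the other.
  Commuting : (Permutation′ n → Carrier) → (Fin 4 → Fin n) → Permutation′ n → Set
  Commuting f b σ =
    f (act b [] σ) + f (act b ((0F , 1F) ∷ (2F , 3F) ∷ []) σ) ≈
    f (act b ((0F , 1F) ∷ []) σ) + f (act b ((2F , 3F) ∷ []) σ)

  commuting-4 : ∀ {f : Permutation′ 4 → Carrier} → Balanced f → Commuting f id Perm.id
  commuting-4 F = swap-difference F {0F} {1F} (λ ()) Perm.id (swap 2F 3F Perm.id) ≡.refl ≡.refl
    λ { 0F l≢0 _ → contradiction ≡.refl l≢0 ; 1F _ l≢1 → contradiction ≡.refl l≢1
      ; 2F _ _ → λ () ; 3F _ _ → λ () }

  -- ρ fixes 0 and 1 and differs from both the identity and (2 4) elsewhere, so it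
  -- links their differences along (0 1).  Three remaining positions, as for n = 5,
  -- are too few for such a ρ.
  commuting-6+ : ∀ {f : Permutation′ (6 ℕ.+ m) → Carrier} → Balanced f →
    Commuting f (0F ∷ᵛ 1F ∷ᵛ 2F ∷ᵛ 4F ∷ᵛ []ᵛ) Perm.id
  commuting-6+ {m} {f} F = ∙-cancelʳ (f ρ + f (swap 0F 1F ρ)) _ _ (begin
    (f Perm.id + f st) + (f ρ + f (swap 0F 1F ρ))
      ≈⟨ solve 4 (λ a b c d → (a ⊕ b) ⊕ (c ⊕ d) ⊜ (a ⊕ d) ⊕ (b ⊕ c)) refl (f Perm.id) (f st) (f ρ) (f (swap 0F 1F ρ)) ⟩
    (f Perm.id + f (swap 0F 1F ρ)) + (f st + f ρ)
      ≈⟨ +-cong id~ρ (sym t~ρ) ⟩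
    (f s + f ρ) + (f t + f (swap 0F 1F ρ))
      ≈⟨ solve 4 (λ a b c d → (a ⊕ b) ⊕ (c ⊕ d) ⊜ (a ⊕ c) ⊕ (b ⊕ d)) refl (f s) (f ρ) (f t) (f (swap 0F 1F ρ)) ⟩
    (f s + f t) + (f ρ + f (swap 0F 1F ρ)) ∎)
    where
    ρ = lift₀ (lift₀ (rotation (3 ℕ.+ m)))
    s = swap 0F 1F Perm.id
    -- `ρ` sends 3 to 2, where it would agree with (2 3); (2 4) avoids this.
    t = swap 2F 4F Perm.id
    st = swap 0F 1F t
    id≢ρ : ∀ l → l ≢ 0F → l ≢ 1F → l ≢ ρ ⟨$⟩ʳ l
    id≢ρ 0F l≢0 _ = contradiction ≡.refl l≢0
    id≢ρ 1F _ l≢1 = contradiction ≡.refl l≢1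
    id≢ρ (suc (suc l)) _ _ eq = rotation-deranges _ l (≡.sym (suc-injective (suc-injective eq)))
    t≢ρ : ∀ l → l ≢ 0F → l ≢ 1F → t ⟨$⟩ʳ l ≢ ρ ⟨$⟩ʳ l
    t≢ρ 0F l≢0 _ = contradiction ≡.refl l≢0
    t≢ρ 1F _ l≢1 = contradiction ≡.refl l≢1
    t≢ρ 2F _ _ = λ ()
    t≢ρ 3F = id≢ρ 3F
    t≢ρ 4F _ _ eq = contradiction (≡.trans eq (cong (2 ↑ʳ_) (rotation-suc (3 ℕ.+ m) 1F))) λ ()
    t≢ρ (suc (suc (suc (suc (suc l))))) = id≢ρ (suc (suc (suc (suc (suc l)))))
    id~ρ = swap-difference F {0F} {1F} (λ ()) Perm.id ρ ≡.refl ≡.refl id≢ρ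
    t~ρ  = swap-difference F {0F} {1F} (λ ()) t ρ ≡.refl ≡.refl t≢ρ

  -- σ is turned into τ from the last position down by transpositions avoiding Fixed.
  agreement : ∀ {g : Permutation′ n → Carrier} → (∀ σ τ → σ Perm.≈ τ → g σ ≈ g τ) → ∀ (Fixed : Fin n → Set) →
    (∀ i j → i ≢ j → ¬ Fixed i → ¬ Fixed j → ∀ σ → g (swap i j σ) ≈ g σ) →
    ∀ σ τ → (∀ i → Fixed i → σ ⟨$⟩ʳ i ≡ τ ⟨$⟩ʳ i) → g σ ≈ g τ
  agreement {n} {g} g-cong Fixed g-swap σ τ σ~τ = sort n σ
    (λ i n≤i → contradiction n≤i (ℕ.<⇒≱ (toℕ<n i))) σ~τ
    where
    sort : ∀ m σ → (∀ i → m ≤ toℕ i → σ ⟨$⟩ʳ i ≡ τ ⟨$⟩ʳ i) → (∀ i → Fixed i → σ ⟨$⟩ʳ i ≡ τ ⟨$⟩ʳ i) → g σ ≈ g τ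
    sort zero    σ agree _    = g-cong σ τ (λ i → agree i z≤n)
    sort (suc m) σ agree σ~τ with any? (λ i → toℕ i ℕ.≟ m)
    -- No bound on `m` is carried along; an `m` that is not a position is skipped.
    ... | no none = sort m σ (λ i m≤i → agree i (ℕ.≤∧≢⇒< m≤i (λ eq → none (i , ≡.sym eq)))) σ~τ
    ... | yes (i , i≡m) with σ ⟨$⟩ʳ i ≟ τ ⟨$⟩ʳ i
    ...   | yes σi≡τi = sort m σ agree′ σ~τ
      where
      agree′ : ∀ l → m ≤ toℕ l → σ ⟨$⟩ʳ l ≡ τ ⟨$⟩ʳ l
      agree′ l m≤l with i ≟ l
      ... | yes ≡.refl = σi≡τi
      ... | no  i≢l    = agree l (ℕ.≤∧≢⇒< m≤l (i≢l ∘ toℕ-injective ∘ ≡.trans i≡m))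
    ...   | no σi≢τi = trans (sym (g-swap i j i≢j ¬Fi ¬Fj σ)) (sort m (swap i j σ) agree′ σ′~τ)
      where
      -- The position where `σ` takes the value wanted at `i`. No position other than `i` that
      -- already agrees can be `j`, so the swap spoils neither settled nor fixed positions.
      j = σ ⟨$⟩ˡ (τ ⟨$⟩ʳ i)
      σj≡τi : σ ⟨$⟩ʳ j ≡ τ ⟨$⟩ʳ i
      σj≡τi = Perm.inverseʳ σ
      i≢j : i ≢ j
      i≢j eq = σi≢τi (≡.trans (cong (σ ⟨$⟩ʳ_) eq) σj≡τi)
      σ≢τ⇒j : ∀ {l} → l ≢ i → σ ⟨$⟩ʳ l ≡ τ ⟨$⟩ʳ l → l ≢ j
      σ≢τ⇒j l≢i eq ≡.refl = l≢i (⟨$⟩ʳ-injective τ (≡.trans (≡.sym eq) σj≡τi))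
      ¬Fi : ¬ Fixed i
      ¬Fi Fi = σi≢τi (σ~τ i Fi)
      ¬Fj : ¬ Fixed j
      ¬Fj Fj = σ≢τ⇒j (≢-sym i≢j) (σ~τ j Fj) ≡.refl
      kept : ∀ {l} → l ≢ i → σ ⟨$⟩ʳ l ≡ τ ⟨$⟩ʳ l → swap i j σ ⟨$⟩ʳ l ≡ τ ⟨$⟩ʳ l
      kept l≢i eq = ≡.trans (cong (σ ⟨$⟩ʳ_) (transpose-mismatch l≢i (σ≢τ⇒j l≢i eq))) eq
      agree′ : ∀ l → m ≤ toℕ l → swap i j σ ⟨$⟩ʳ l ≡ τ ⟨$⟩ʳ l
      agree′ l m≤l with i ≟ l
      ... | yes ≡.refl = ≡.trans (cong (σ ⟨$⟩ʳ_) (transpose-matchˡ i j)) σj≡τi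
      ... | no  i≢l    = kept (≢-sym i≢l) (agree l (ℕ.≤∧≢⇒< m≤l (i≢l ∘ toℕ-injective ∘ ≡.trans i≡m)))
      σ′~τ : ∀ l → Fixed l → swap i j σ ⟨$⟩ʳ l ≡ τ ⟨$⟩ʳ l
      σ′~τ l Fl = kept (λ { ≡.refl → ¬Fi Fl }) (σ~τ l Fl)

  difference : ∀ {a b c d} → a + d ≈ c + b → a - b ≈ c - d
  difference {a} {b} {c} {d} eq = ∙-cancelʳ (b + d) _ _ (begin
    (a - b) + (b + d)      ≈⟨ solve 4 (λ a b b⁻ d → (a ⊕ b⁻) ⊕ (b ⊕ d) ⊜ (a ⊕ d) ⊕ (b ⊕ b⁻)) refl a b (- b) d ⟩
    (a + d) + (b + - b)    ≈⟨ +-cong eq (trans (inverseʳ b) (sym (inverseʳ d))) ⟩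
    (c + b) + (d + - d)    ≈⟨ solve 4 (λ c b d d⁻ → (c ⊕ b) ⊕ (d ⊕ d⁻) ⊜ (c ⊕ d⁻) ⊕ (b ⊕ d)) refl c b d (- d) ⟩
    (c - d) + (b + d)      ∎)

  difference⁻¹ : ∀ {a b c d} → a - b ≈ c - d → a + d ≈ c + b
  difference⁻¹ {a} {b} {c} {d} eq = begin
    a + d                  ≈⟨ identityʳ _ ⟨
    (a + d) + 0#           ≈⟨ +-congˡ (inverseʳ b) ⟨
    (a + d) + (b + - b)    ≈⟨ solve 4 (λ a b b⁻ d → (a ⊕ d) ⊕ (b ⊕ b⁻) ⊜ (a ⊕ b⁻) ⊕ (b ⊕ d)) refl a b (- b) d ⟩
    (a - b) + (b + d)      ≈⟨ +-congʳ eq ⟩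
    (c - d) + (b + d)      ≈⟨ solve 4 (λ c b d d⁻ → (c ⊕ d⁻) ⊕ (b ⊕ d) ⊜ (c ⊕ b) ⊕ (d ⊕ d⁻)) refl c b d (- d) ⟩
    (c + b) + (d + - d)    ≈⟨ +-congˡ (inverseʳ d) ⟩
    (c + b) + 0#           ≈⟨ identityʳ _ ⟩
    c + b                  ∎

  sum-differ : ∀ (g h : Fin n → Carrier) i → (∀ l → l ≢ i → g l ≈ h l) → sum g + h i ≈ sum h + g i
  sum-differ g h zero eq = begin
    (g zero + sum (g ∘ suc)) + h zero   ≈⟨ +-congʳ (+-congˡ (sum-cong-≋ λ l → eq (suc l) λ ())) ⟩
    (g zero + sum (h ∘ suc)) + h zero   ≈⟨ solve 3 (λ a b c → (a ⊕ b) ⊕ c ⊜ (c ⊕ b) ⊕ a) refl (g zero) (sum (h ∘ suc)) (h zero) ⟩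
    (h zero + sum (h ∘ suc)) + g zero   ∎
  sum-differ g h (suc i) eq = begin
    (g zero + sum (g ∘ suc)) + h (suc i)   ≈⟨ assoc _ _ _ ⟩
    g zero + (sum (g ∘ suc) + h (suc i))   ≈⟨ +-cong (eq zero λ ()) (sum-differ (g ∘ suc) (h ∘ suc) i λ l l≢i → eq (suc l) (l≢i ∘ suc-injective)) ⟩
    h zero + (sum (h ∘ suc) + g (suc i))   ≈⟨ assoc _ _ _ ⟨
    (h zero + sum (h ∘ suc)) + g (suc i)   ∎

  -- Mixed differences and the alternating sum over three positions

  module TorsionFree (2-torsion-free : ∀ z → z + z ≈ 0# → z ≈ 0#) where

    -- y changes sign under every adjacent transposition of positions: the 3-cycles of
    -- the positions other than 3 and 4, or than 0 and 1, link it to itself.  So the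
    -- sums of y over the two squares are 5 y(id) and 3 y(id).
    module Five {f : Permutation′ 5 → Carrier} (F : Balanced f) where

      y⁺ y⁻ y : Permutation′ 5 → Carrier
      y⁺ σ = f σ + f (swap 0F 1F (swap 3F 4F σ))
      y⁻ σ = f (swap 0F 1F σ) + f (swap 3F 4F σ)
      y σ = y⁺ σ + - y⁻ σ

      y-balanced : Balanced y
      y-balanced = balanced-+ (balanced-+ F (translate F (transpose 0F 1F ∘ₚ transpose 3F 4F) Perm.id))
        (balanced-neg (balanced-+ (translate F (transpose 0F 1F) Perm.id) (translate F (transpose 3F 4F) Perm.id)))

      s₀₁ s₁₂ s₂₃ s₃₄ : Permutation′ 5 → Permutation′ 5
      s₀₁ = swap 0F 1F
      s₁₂ = swap 1F 2F
      s₂₃ = swap 2F 3F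
      s₃₄ = swap 3F 4F

      same : ∀ {σ τ} → σ ⟨$⟩ʳ 0F ≡ τ ⟨$⟩ʳ 0F → σ ⟨$⟩ʳ 1F ≡ τ ⟨$⟩ʳ 1F → σ ⟨$⟩ʳ 2F ≡ τ ⟨$⟩ʳ 2F →
        σ ⟨$⟩ʳ 3F ≡ τ ⟨$⟩ʳ 3F → σ ⟨$⟩ʳ 4F ≡ τ ⟨$⟩ʳ 4F → f σ ≈ f τ
      same {σ} {τ} p₀ p₁ p₂ p₃ p₄ = congruent F σ τ λ { 0F → p₀ ; 1F → p₁ ; 2F → p₂ ; 3F → p₃ ; 4F → p₄ }

      difference₀₁ : ∀ σ ρ → σ ⟨$⟩ʳ 0F ≡ ρ ⟨$⟩ʳ 0F → σ ⟨$⟩ʳ 1F ≡ ρ ⟨$⟩ʳ 1F →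
        σ ⟨$⟩ʳ 2F ≢ ρ ⟨$⟩ʳ 2F → σ ⟨$⟩ʳ 3F ≢ ρ ⟨$⟩ʳ 3F → σ ⟨$⟩ʳ 4F ≢ ρ ⟨$⟩ʳ 4F →
        f σ + f (s₀₁ ρ) ≈ f (s₀₁ σ) + f ρ
      difference₀₁ σ ρ p₀ p₁ p₂ p₃ p₄ = swap-difference F (λ ()) σ ρ p₀ p₁ λ
        { 0F l≢0 _ → contradiction ≡.refl l≢0 ; 1F _ l≢1 → contradiction ≡.refl l≢1
        ; 2F _ _ → p₂ ; 3F _ _ → p₃ ; 4F _ _ → p₄ }

      difference₃₄ : ∀ σ ρ → σ ⟨$⟩ʳ 0F ≢ ρ ⟨$⟩ʳ 0F → σ ⟨$⟩ʳ 1F ≢ ρ ⟨$⟩ʳ 1F → σ ⟨$⟩ʳ 2F ≢ ρ ⟨$⟩ʳ 2F →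
        σ ⟨$⟩ʳ 3F ≡ ρ ⟨$⟩ʳ 3F → σ ⟨$⟩ʳ 4F ≡ ρ ⟨$⟩ʳ 4F →
        f σ + f (s₃₄ ρ) ≈ f (s₃₄ σ) + f ρ
      difference₃₄ σ ρ p₀ p₁ p₂ p₃ p₄ = swap-difference F (λ ()) σ ρ p₃ p₄ λ
        { 0F _ _ → p₀ ; 1F _ _ → p₁ ; 2F _ _ → p₂
        ; 3F l≢3 _ → contradiction ≡.refl l≢3 ; 4F _ l≢4 → contradiction ≡.refl l≢4 }

      opposite : ∀ σ τ → y⁺ σ + y⁺ τ ≈ y⁻ σ + y⁻ τ → y σ ≈ - y τ
      opposite σ τ eq = inverseˡ-unique (y σ) (y τ) (begin
        (y⁺ σ + - y⁻ σ) + (y⁺ τ + - y⁻ τ)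
          ≈⟨ solve 4 (λ a b c d → (a ⊕ b) ⊕ (c ⊕ d) ⊜ (a ⊕ c) ⊕ (b ⊕ d)) refl (y⁺ σ) (- y⁻ σ) (y⁺ τ) (- y⁻ τ) ⟩
        (y⁺ σ + y⁺ τ) + (- y⁻ σ + - y⁻ τ)
          ≈⟨ +-cong eq (⁻¹-∙-comm (y⁻ σ) (y⁻ τ)) ⟩
        (y⁻ σ + y⁻ τ) + - (y⁻ σ + y⁻ τ)
          ≈⟨ inverseʳ _ ⟩
        0# ∎)

      opposite′ : ∀ σ τ → y⁺ σ ≈ y⁻ τ → y⁺ τ ≈ y⁻ σ → y σ ≈ - y τ
      opposite′ σ τ p q = opposite σ τ (trans (+-cong p q) (+-comm _ _))

      y-swap : ∀ i σ → y (swap (inject₁ i) (suc i) σ) ≈ - y σ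
      -- (0 1) and (3 4) merely exchange `y⁺` and `y⁻`; only (1 2) and (2 3) draw on the balance of
      -- `f`.
      y-swap 0F σ = opposite′ (s₀₁ σ) σ
        (+-congˡ (same ≡.refl ≡.refl ≡.refl ≡.refl ≡.refl))
        (+-cong (same ≡.refl ≡.refl ≡.refl ≡.refl ≡.refl) (same ≡.refl ≡.refl ≡.refl ≡.refl ≡.refl))
      y-swap 1F σ = opposite (s₁₂ σ) σ (begin
        (f (s₁₂ σ) + f (s₀₁ (s₃₄ (s₁₂ σ)))) + (f σ + f (s₀₁ (s₃₄ σ)))
          ≈⟨ +-cong (+-congˡ (same ≡.refl ≡.refl ≡.refl ≡.refl ≡.refl))
                    (+-congˡ (same ≡.refl ≡.refl ≡.refl ≡.refl ≡.refl)) ⟩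
        (f (s₁₂ σ) + f (s₃₄ (s₀₁ (s₁₂ σ)))) + (f σ + f (s₃₄ (s₀₁ σ)))
          ≈⟨ solve 4 (λ a b c d → (a ⊕ b) ⊕ (c ⊕ d) ⊜ (a ⊕ d) ⊕ (b ⊕ c)) refl
               (f (s₁₂ σ)) (f (s₃₄ (s₀₁ (s₁₂ σ)))) (f σ) (f (s₃₄ (s₀₁ σ))) ⟩
        (f (s₁₂ σ) + f (s₃₄ (s₀₁ σ))) + (f (s₃₄ (s₀₁ (s₁₂ σ))) + f σ)
          -- The two permutations in each pair differ by a 3-cycle of the positions 0, 1, 2, hence
          -- have equal differences along (3 4).
          ≈⟨ +-cong
               (difference₃₄ (s₁₂ σ) (s₀₁ σ) (≢σ λ ()) (≢σ λ ()) (≢σ λ ()) ≡.refl ≡.refl)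
               (sym (difference₃₄ (s₀₁ (s₁₂ σ)) σ (≢σ λ ()) (≢σ λ ()) (≢σ λ ()) ≡.refl ≡.refl)) ⟩
        (f (s₃₄ (s₁₂ σ)) + f (s₀₁ σ)) + (f (s₀₁ (s₁₂ σ)) + f (s₃₄ σ))
          ≈⟨ solve 4 (λ a b c d → (a ⊕ b) ⊕ (c ⊕ d) ⊜ (c ⊕ a) ⊕ (b ⊕ d)) refl
               (f (s₃₄ (s₁₂ σ))) (f (s₀₁ σ)) (f (s₀₁ (s₁₂ σ))) (f (s₃₄ σ)) ⟩
        (f (s₀₁ (s₁₂ σ)) + f (s₃₄ (s₁₂ σ))) + (f (s₀₁ σ) + f (s₃₄ σ)) ∎)
        where
        ≢σ : ∀ {i j} → i ≢ j → σ ⟨$⟩ʳ i ≢ σ ⟨$⟩ʳ j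
        ≢σ i≢j = i≢j ∘ ⟨$⟩ʳ-injective σ
      y-swap 2F σ = opposite (s₂₃ σ) σ (begin
        (f (s₂₃ σ) + f (s₀₁ (s₃₄ (s₂₃ σ)))) + (f σ + f (s₀₁ (s₃₄ σ)))
          ≈⟨ solve 4 (λ a b c d → (a ⊕ b) ⊕ (c ⊕ d) ⊜ (a ⊕ d) ⊕ (b ⊕ c)) refl
               (f (s₂₃ σ)) (f (s₀₁ (s₃₄ (s₂₃ σ)))) (f σ) (f (s₀₁ (s₃₄ σ))) ⟩
        (f (s₂₃ σ) + f (s₀₁ (s₃₄ σ))) + (f (s₀₁ (s₃₄ (s₂₃ σ))) + f σ)
          ≈⟨ +-cong
               (difference₀₁ (s₂₃ σ) (s₃₄ σ) ≡.refl ≡.refl (≢σ λ ()) (≢σ λ ()) (≢σ λ ()))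
               (sym (difference₀₁ (s₃₄ (s₂₃ σ)) σ ≡.refl ≡.refl (≢σ λ ()) (≢σ λ ()) (≢σ λ ()))) ⟩
        (f (s₀₁ (s₂₃ σ)) + f (s₃₄ σ)) + (f (s₃₄ (s₂₃ σ)) + f (s₀₁ σ))
          ≈⟨ solve 4 (λ a b c d → (a ⊕ b) ⊕ (c ⊕ d) ⊜ (a ⊕ c) ⊕ (d ⊕ b)) refl
               (f (s₀₁ (s₂₃ σ))) (f (s₃₄ σ)) (f (s₃₄ (s₂₃ σ))) (f (s₀₁ σ)) ⟩
        (f (s₀₁ (s₂₃ σ)) + f (s₃₄ (s₂₃ σ))) + (f (s₀₁ σ) + f (s₃₄ σ)) ∎)
        where
        ≢σ : ∀ {i j} → i ≢ j → σ ⟨$⟩ʳ i ≢ σ ⟨$⟩ʳ j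
        ≢σ i≢j = i≢j ∘ ⟨$⟩ʳ-injective σ
      y-swap 3F σ = opposite′ (s₃₄ σ) σ
        (trans (+-comm _ _) (+-congʳ (same ≡.refl ≡.refl ≡.refl ≡.refl ≡.refl)))
        (trans (+-comm _ _) (+-congˡ (same ≡.refl ≡.refl ≡.refl ≡.refl ≡.refl)))

      odd : List (Fin 4) → Bool
      odd []      = false
      odd (_ ∷ w) = not (odd w)

      signed : Bool → Carrier
      signed b = if b then - y Perm.id else y Perm.id

      signed-not : ∀ b → - signed b ≈ signed (not b)
      signed-not false = refl
      signed-not true  = ⁻¹-involutive _

      y-adjacentSwaps : ∀ w → y (adjacentSwaps w) ≈ signed (odd w)
      y-adjacentSwaps []      = refl
      y-adjacentSwaps (i ∷ w) = begin
        y (swap (inject₁ i) (suc i) (adjacentSwaps w))   ≈⟨ y-swap i (adjacentSwaps w) ⟩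
        - y (adjacentSwaps w)                            ≈⟨ ⁻¹-cong (y-adjacentSwaps w) ⟩
        - signed (odd w)                                 ≈⟨ signed-not (odd w) ⟩
        signed (not (odd w))                             ∎

      squares : ∀ (d e : Fin 5 → List (Fin 4)) →
        PairwiseDisjoint (adjacentSwaps ∘ d) → PairwiseDisjoint (adjacentSwaps ∘ e) →
        sum (signed ∘ odd ∘ d) ≈ sum (signed ∘ odd ∘ e)
      squares d e d-disjoint e-disjoint = begin
        sum (signed ∘ odd ∘ d)        ≈⟨ sum-cong-≋ (y-adjacentSwaps ∘ d) ⟨
        sum (y ∘ adjacentSwaps ∘ d)   ≈⟨ balanced y-balanced (adjacentSwaps ∘ d) (adjacentSwaps ∘ e) d-disjoint e-disjoint ⟩
        sum (y ∘ adjacentSwaps ∘ e)   ≈⟨ sum-cong-≋ (y-adjacentSwaps ∘ e) ⟩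
        sum (signed ∘ odd ∘ e)        ∎

      y-id : y Perm.id ≈ 0#
      y-id = 2-torsion-free z (trans (+-congˡ z≈-z) (inverseʳ z))
        where
        z = y Perm.id
        z≈-z : z ≈ - z
        -- The signs of the two squares differ in the second row only; the other rows cancel.
        z≈-z = ∙-cancelʳ (z + (z + (z + 0#))) z (- z) (∙-cancelˡ z _ _ (squares evenSquare oddSquare even-disjoint odd-disjoint))

    commuting-5 : ∀ {f : Permutation′ 5 → Carrier} → Balanced f →
      Commuting f (0F ∷ᵛ 1F ∷ᵛ 3F ∷ᵛ 4F ∷ᵛ []ᵛ) Perm.id
    commuting-5 F = x∙y⁻¹≈ε⇒x≈y _ _ (Five.y-id F)

    -- One quadruple of positions per size is enough, since translation carries it to any other.
    Labels : ℕ → Set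
    Labels n = Σ[ a ∈ (Fin 4 → Fin n) ] Injective _≡_ _≡_ a
      × (∀ {f} → Balanced f → Commuting f a Perm.id)

    labels : ∀ m → Labels (4 ℕ.+ m)
    labels zero          = id , id , commuting-4
    labels (suc zero)    = 0F ∷ᵛ 1F ∷ᵛ 3F ∷ᵛ 4F ∷ᵛ []ᵛ
      , distinct₄ (λ ()) (λ ()) (λ ()) (λ ()) (λ ()) (λ ()) , commuting-5
    labels (suc (suc m)) = 0F ∷ᵛ 1F ∷ᵛ 2F ∷ᵛ 4F ∷ᵛ []ᵛ
      , distinct₄ (λ ()) (λ ()) (λ ()) (λ ()) (λ ()) (λ ()) , commuting-6+

    commuting : ∀ {f : Permutation′ n → Carrier} → Balanced f → ∀ b → Injective _≡_ _≡_ b →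
      ∀ σ → Commuting f b σ
    commuting {f = f} F b b-inj σ with subst Labels (ℕ.m+[n∸m]≡n (injective⇒≤ b-inj)) (labels _)
    ... | a , a-inj , commutes with extend-injection a b a-inj b-inj
    ...   | π , πa≡b = begin
      f (act b [] σ) + f (act b ((0F , 1F) ∷ (2F , 3F) ∷ []) σ)
        ≈⟨ +-cong (conj []) (conj ((0F , 1F) ∷ (2F , 3F) ∷ [])) ⟨
      g (act a [] Perm.id) + g (act a ((0F , 1F) ∷ (2F , 3F) ∷ []) Perm.id)
        ≈⟨ commutes (translate F (Perm.flip π) (π ∘ₚ σ)) ⟩
      g (act a ((0F , 1F) ∷ []) Perm.id) + g (act a ((2F , 3F) ∷ []) Perm.id)
        ≈⟨ +-cong (conj ((0F , 1F) ∷ [])) (conj ((2F , 3F) ∷ [])) ⟩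
      f (act b ((0F , 1F) ∷ []) σ) + f (act b ((2F , 3F) ∷ []) σ) ∎
      where
      g : Permutation′ _ → Carrier
      g e = f (Perm.flip π ∘ₚ e ∘ₚ π ∘ₚ σ)
      conj : ∀ w → g (act a w Perm.id) ≈ f (act b w σ)
      conj w = congruent F _ (act b w σ) (act-conjugate π πa≡b w σ)

    -- By `commuting`, transposing two positions other than `i` and `j` leaves f(σ) - f(σ ∘ (i j))
    -- unchanged, and such transpositions connect `σ` to `τ`.
    swap-difference-agree : ∀ {f : Permutation′ n → Carrier} → Balanced f → ∀ {i j} → i ≢ j → ∀ σ τ →
      σ ⟨$⟩ʳ i ≡ τ ⟨$⟩ʳ i → σ ⟨$⟩ʳ j ≡ τ ⟨$⟩ʳ j → f σ + f (swap i j τ) ≈ f τ + f (swap i j σ)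
    swap-difference-agree {f = f} F {i} {j} i≢j σ τ σi≡τi σj≡τj = difference⁻¹
      (agreement {g = λ σ → f σ - f (swap i j σ)}
        (λ σ τ σ≈τ → +-cong (congruent F σ τ σ≈τ) (⁻¹-cong (congruent F (swap i j σ) (swap i j τ) λ l → σ≈τ _)))
        (λ l → l ≡ i ⊎ l ≡ j) invariant σ τ λ { l (inj₁ ≡.refl) → σi≡τi ; l (inj₂ ≡.refl) → σj≡τj })
      where
      invariant : ∀ k l → k ≢ l → ¬ (k ≡ i ⊎ k ≡ j) → ¬ (l ≡ i ⊎ l ≡ j) → ∀ σ →
        f (swap k l σ) - f (swap i j (swap k l σ)) ≈ f σ - f (swap i j σ)
      invariant k l k≢l k∉ l∉ σ = sym (difference (trans
        (commuting F (i ∷ᵛ j ∷ᵛ k ∷ᵛ l ∷ᵛ []ᵛ)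
          (distinct₄ i≢j (λ { ≡.refl → k∉ (inj₁ ≡.refl) }) (λ { ≡.refl → l∉ (inj₁ ≡.refl) })
            (λ { ≡.refl → k∉ (inj₂ ≡.refl) }) (λ { ≡.refl → l∉ (inj₂ ≡.refl) }) k≢l) σ)
        (+-comm _ _)))

    Alternating : (Permutation′ n → Carrier) → (Fin 3 → Fin n) → Permutation′ n → Set
    Alternating f b σ =
      f (act b [] σ) + f (act b ((0F , 1F) ∷ (1F , 2F) ∷ []) σ) + f (act b ((1F , 2F) ∷ (0F , 1F) ∷ []) σ) ≈
      f (act b ((0F , 1F) ∷ []) σ) + f (act b ((1F , 2F) ∷ []) σ) + f (act b ((0F , 2F) ∷ []) σ)

    -- The index of a word is the one-line notation of its value.  Twice the alternating
    -- sum over the first three positions is a combination, with coefficients ±1, of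
    -- nine instances of commuting, found by computer.
    module FourPositions {f : Permutation′ n → Carrier} (F-balanced : Balanced f)
      {b : Fin 4 → Fin n} (b-inj : Injective _≡_ _≡_ b) (σ : Permutation′ n) where

      F : Word 4 → Carrier
      F w = f (act b w σ)

      F-cong : ∀ w w′ → eval w Perm.≈ eval w′ → F w ≈ F w′
      F-cong w w′ eq = congruent F-balanced (act b w σ) (act b w′ σ) (act-cong b-inj w w′ eq σ)

      distinct? : (i j k l : Fin 4) → Dec (i ≢ j × i ≢ k × i ≢ l × j ≢ k × j ≢ l × k ≢ l)
      distinct? i j k l = ¬? (i ≟ j) ×-dec ¬? (i ≟ k) ×-dec ¬? (i ≟ l)
        ×-dec ¬? (j ≟ k) ×-dec ¬? (j ≟ l) ×-dec ¬? (k ≟ l)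

      -- `commuting` at `act b w σ`, with its other three terms moved to chosen representatives. The
      -- implicit arguments are discharged by evaluation on four labels.
      relation : ∀ i j k l w w₁ w₂ w₃ → {True (distinct? i j k l)} →
        {True (eval ((i , j) ∷ (k , l) ∷ w) ≈? eval w₁)} →
        {True (eval ((i , j) ∷ w) ≈? eval w₂)} →
        {True (eval ((k , l) ∷ w) ≈? eval w₃)} →
        F w + F w₁ ≈ F w₂ + F w₃
      relation i j k l w w₁ w₂ w₃ {distinct} {e₁} {e₂} {e₃} with toWitness distinct
      ... | i≢j , i≢k , i≢l , j≢k , j≢l , k≢l = begin
        F w + F w₁                             ≈⟨ +-congˡ (F-cong ((i , j) ∷ (k , l) ∷ w) w₁ (toWitness e₁)) ⟨
        F w + F ((i , j) ∷ (k , l) ∷ w)        ≈⟨ commuting F-balanced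
          (b i ∷ᵛ b j ∷ᵛ b k ∷ᵛ b l ∷ᵛ []ᵛ)
          (distinct₄ (i≢j ∘ b-inj) (i≢k ∘ b-inj) (i≢l ∘ b-inj) (j≢k ∘ b-inj) (j≢l ∘ b-inj) (k≢l ∘ b-inj))
          (act b w σ) ⟩
        F ((i , j) ∷ w) + F ((k , l) ∷ w)      ≈⟨ +-cong (F-cong ((i , j) ∷ w) w₂ (toWitness e₂)) (F-cong ((k , l) ∷ w) w₃ (toWitness e₃)) ⟩
        F w₂ + F w₃                            ∎

      w₀₁₂₃ w₀₁₃₂ w₀₂₁₃ w₀₃₂₁ w₁₀₂₃ w₂₁₀₃ w₀₂₃₁ w₀₃₁₂ w₁₀₃₂ w₁₂₀₃ w₂₀₁₃ w₂₃₀₁ w₃₀₂₁ w₁₃₀₂ w₂₀₃₁ w₃₀₁₂ w₃₂₀₁ w₃₁₀₂ : Word 4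
      w₀₁₂₃ = []
      w₀₁₃₂ = (2F , 3F) ∷ []
      w₀₂₁₃ = (1F , 2F) ∷ []
      w₀₃₂₁ = (1F , 3F) ∷ []
      w₁₀₂₃ = (0F , 1F) ∷ []
      w₂₁₀₃ = (0F , 2F) ∷ []
      w₀₂₃₁ = (2F , 3F) ∷ (1F , 2F) ∷ []
      w₀₃₁₂ = (2F , 3F) ∷ (1F , 3F) ∷ []
      w₁₀₃₂ = (0F , 1F) ∷ (2F , 3F) ∷ []
      w₁₂₀₃ = (1F , 2F) ∷ (0F , 1F) ∷ []
      w₂₀₁₃ = (0F , 1F) ∷ (1F , 2F) ∷ []
      w₂₃₀₁ = (1F , 3F) ∷ (0F , 2F) ∷ []
      w₃₀₂₁ = (0F , 1F) ∷ (1F , 3F) ∷ []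
      w₁₃₀₂ = (0F , 2F) ∷ (2F , 3F) ∷ (1F , 3F) ∷ []
      w₂₀₃₁ = (2F , 3F) ∷ (0F , 1F) ∷ (1F , 2F) ∷ []
      w₃₀₁₂ = (0F , 1F) ∷ (2F , 3F) ∷ (1F , 3F) ∷ []
      w₃₂₀₁ = (1F , 2F) ∷ (0F , 1F) ∷ (1F , 3F) ∷ []
      w₃₁₀₂ = (1F , 2F) ∷ (0F , 1F) ∷ (2F , 3F) ∷ (1F , 3F) ∷ []

      evens odds lhs rhs : Carrier
      evens = F w₀₁₂₃ + F w₂₀₁₃ + F w₁₂₀₃
      odds = F w₁₀₂₃ + F w₀₂₁₃ + F w₂₁₀₃
      lhs = (F w₀₁₂₃ + F w₁₀₃₂) + ((F w₀₁₂₃ + F w₂₃₀₁) + ((F w₀₃₂₁ + F w₃₀₁₂) + ((F w₂₀₁₃ + F w₃₁₀₂) + ((F w₀₃₁₂ + F w₁₂₀₃) + ((F w₃₀₂₁ + F w₁₂₀₃) + ((F w₀₂₃₁ + F w₂₀₁₃) + ((F w₂₀₃₁ + F w₁₃₀₂) + ((F w₀₁₃₂ + F w₃₂₀₁)))))))))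
      rhs = (F w₁₀₂₃ + F w₀₁₃₂) + ((F w₀₃₂₁ + F w₂₁₀₃) + ((F w₃₀₂₁ + F w₀₃₁₂) + ((F w₃₀₁₂ + F w₂₁₀₃) + ((F w₁₃₀₂ + F w₀₂₁₃) + ((F w₃₂₀₁ + F w₁₀₂₃) + ((F w₀₂₁₃ + F w₂₀₃₁) + ((F w₁₀₃₂ + F w₂₃₀₁) + ((F w₃₁₀₂ + F w₀₂₃₁)))))))))

      lhs≈rhs : lhs ≈ rhs
      lhs≈rhs =
        -- `sym` marks the relations taken with coefficient -1.
        (+-cong (relation 0F 1F 2F 3F w₀₁₂₃ w₁₀₃₂ w₁₀₂₃ w₀₁₃₂)
        (+-cong (relation 1F 3F 0F 2F w₀₁₂₃ w₂₃₀₁ w₀₃₂₁ w₂₁₀₃)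
        (+-cong (relation 0F 1F 2F 3F w₀₃₂₁ w₃₀₁₂ w₃₀₂₁ w₀₃₁₂)
        (+-cong (sym (relation 0F 3F 1F 2F w₃₀₁₂ w₂₁₀₃ w₂₀₁₃ w₃₁₀₂))
        (+-cong (relation 0F 2F 1F 3F w₀₃₁₂ w₁₂₀₃ w₁₃₀₂ w₀₂₁₃)
        (+-cong (relation 1F 2F 0F 3F w₃₀₂₁ w₁₂₀₃ w₃₂₀₁ w₁₀₂₃)
        (+-cong (sym (relation 2F 3F 0F 1F w₀₂₁₃ w₂₀₃₁ w₀₂₃₁ w₂₀₁₃))
        (+-cong (sym (relation 0F 3F 1F 2F w₁₀₃₂ w₂₃₀₁ w₂₀₃₁ w₁₃₀₂))
        (sym (relation 0F 2F 1F 3F w₃₁₀₂ w₀₂₃₁ w₀₁₃₂ w₃₂₀₁))))))))))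

      doubled : evens + evens ≈ odds + odds
      doubled = ∙-cancelʳ rhs _ _ (begin
        -- The twelve words moving 3 occur once in `lhs` and once in `rhs`. Of the six fixing 3, the
        -- even ones occur twice in `lhs` and the odd ones twice in `rhs`.
        (evens + evens) + rhs   ≈⟨ solve 18 (λ a b c d e f g h i j k l m n o p q r →
            (((a ⊕ k) ⊕ j) ⊕ ((a ⊕ k) ⊕ j)) ⊕ ((e ⊕ b) ⊕ ((d ⊕ f) ⊕ ((m ⊕ h) ⊕ ((p ⊕ f) ⊕ ((n ⊕ c) ⊕ ((q ⊕ e) ⊕ ((c ⊕ o) ⊕ ((i ⊕ l) ⊕ ((r ⊕ g))))))))))
              ⊜ (((e ⊕ c) ⊕ f) ⊕ ((e ⊕ c) ⊕ f)) ⊕ ((a ⊕ i) ⊕ ((a ⊕ l) ⊕ ((d ⊕ p) ⊕ ((k ⊕ r) ⊕ ((h ⊕ j) ⊕ ((m ⊕ j) ⊕ ((g ⊕ k) ⊕ ((o ⊕ n) ⊕ ((b ⊕ q)))))))))))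
          refl (F w₀₁₂₃) (F w₀₁₃₂) (F w₀₂₁₃) (F w₀₃₂₁) (F w₁₀₂₃) (F w₂₁₀₃) (F w₀₂₃₁) (F w₀₃₁₂) (F w₁₀₃₂) (F w₁₂₀₃) (F w₂₀₁₃) (F w₂₃₀₁) (F w₃₀₂₁) (F w₁₃₀₂) (F w₂₀₃₁) (F w₃₀₁₂) (F w₃₂₀₁) (F w₃₁₀₂) ⟩
        (odds + odds) + lhs     ≈⟨ +-congˡ lhs≈rhs ⟩
        (odds + odds) + rhs     ∎)

      evens≈odds : evens ≈ odds
      evens≈odds = x∙y⁻¹≈ε⇒x≈y evens odds (2-torsion-free (evens - odds) (begin
        (evens - odds) + (evens - odds)          ≈⟨ solve 2 (λ a b → (a ⊕ b) ⊕ (a ⊕ b) ⊜ (a ⊕ a) ⊕ (b ⊕ b)) refl evens (- odds) ⟩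
        (evens + evens) + (- odds + - odds)      ≈⟨ +-cong doubled (⁻¹-∙-comm odds odds) ⟩
        (odds + odds) + - (odds + odds)          ≈⟨ inverseʳ (odds + odds) ⟩
        0#                                       ∎))

    -- There is no fourth position to use, but the even and the odd permutations of three objects
    -- are themselves two one-factorizations.
    alternating-3 : ∀ {f : Permutation′ 3 → Carrier} → Balanced f → ∀ b → Injective _≡_ _≡_ b →
      ∀ σ → Alternating f b σ
    alternating-3 {f} F b b-inj σ = begin
      (f (e 0F) + f (e 1F)) + f (e 2F)          ≈⟨ solve 3 (λ a b c → (a ⊕ b) ⊕ c ⊜ a ⊕ (b ⊕ c)) refl (f (e 0F)) (f (e 1F)) (f (e 2F)) ⟩
      f (e 0F) + (f (e 1F) + f (e 2F))          ≈⟨ +-congˡ (+-congˡ (identityʳ _)) ⟨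
      sum (f ∘ e)                               ≈⟨ balanced F e o
                                                   (act-disjoint evenWords (from-yes (pairwiseDisjoint? (eval ∘ evenWords))))
                                                   (act-disjoint oddWords (from-yes (pairwiseDisjoint? (eval ∘ oddWords)))) ⟩
      sum (f ∘ o)                               ≈⟨ +-congˡ (+-congˡ (identityʳ _)) ⟩
      f (o 0F) + (f (o 1F) + f (o 2F))          ≈⟨ solve 3 (λ a b c → (a ⊕ b) ⊕ c ⊜ a ⊕ (b ⊕ c)) refl (f (o 0F)) (f (o 1F)) (f (o 2F)) ⟨
      (f (o 0F) + f (o 1F)) + f (o 2F)          ∎
      where
      evenWords oddWords : Fin 3 → Word 3
      evenWords = [] ∷ᵛ ((0F , 1F) ∷ (1F , 2F) ∷ []) ∷ᵛ ((1F , 2F) ∷ (0F , 1F) ∷ []) ∷ᵛ []ᵛ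
      oddWords = ((0F , 1F) ∷ []) ∷ᵛ ((1F , 2F) ∷ []) ∷ᵛ ((0F , 2F) ∷ []) ∷ᵛ []ᵛ
      e o : Fin 3 → Permutation′ 3
      e i = act b (evenWords i) σ
      o i = act b (oddWords i) σ
      act-disjoint : ∀ w → (∀ i j → i ≢ j → Disjoint (eval (w i)) (eval (w j))) → PairwiseDisjoint (λ i → act b (w i) σ)
      act-disjoint w w-disjoint {i} {j} i≢j l eq with injective⇒surjective b-inj l
      ... | m , ≡.refl = w-disjoint i j i≢j m (b-inj (⟨$⟩ʳ-injective σ
        (≡.trans (≡.sym (act-image b-inj (w i) σ m)) (≡.trans eq (act-image b-inj (w j) σ m)))))

    alternating : ∀ {f : Permutation′ n → Carrier} → Balanced f → ∀ b → Injective _≡_ _≡_ b →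
      ∀ σ → Alternating f b σ
    alternating {n = 3} F b b-inj σ = alternating-3 F b b-inj σ
    alternating {n = suc (suc (suc (suc n)))} F b b-inj σ with missed-by (s≤s (s≤s (s≤s (s≤s z≤n)))) b
    ... | l , l∉b = FourPositions.evens≈odds F (distinct₄ {h = b 0F} {b 1F} {b 2F} {l}
      ((λ ()) ∘ b-inj) ((λ ()) ∘ b-inj) (≢-sym (l∉b 0F)) ((λ ()) ∘ b-inj) (≢-sym (l∉b 1F)) (≢-sym (l∉b 2F))) σ
    alternating {n = 0} F b = contradiction (b 0F) λ ()
    alternating {n = 1} F b b-inj = contradiction (injective⇒≤ b-inj) λ { (s≤s ()) }
    alternating {n = 2} F b b-inj = contradiction (injective⇒≤ b-inj) λ { (s≤s (s≤s ())) }

    -- The affine form of a balanced function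

    module _ {f : Permutation′ (suc n) → Carrier} (F : Balanced f) where

      -- Coefficients that vanish in row 0 and on the diagonal are forced by f-swap at
      -- σ = (0 b), which fixes suc i when b ≢ suc i.
      coefficient : Fin (suc n) → Fin (suc n) → Carrier
      coefficient zero    b = 0#
      coefficient (suc i) b = if does (b ≟ suc i) then 0#
        else f (swap zero (suc i) (swap zero b Perm.id)) - f (swap zero b Perm.id)

      coefficient-diagonal : ∀ i → coefficient i i ≈ 0#
      coefficient-diagonal zero = refl
      coefficient-diagonal (suc i) rewrite dec-true (suc i ≟ suc i) ≡.refl = refl

      coefficient-≢ : ∀ {i b} → b ≢ suc i →
        coefficient (suc i) b ≡ f (swap zero (suc i) (swap zero b Perm.id)) - f (swap zero b Perm.id)
      coefficient-≢ {i} {b} b≢i rewrite dec-false (b ≟ suc i) b≢i = ≡.refl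

      -- `σ` and (0 σ(0)) have the same values at `zero` and `suc i`, hence the same difference
      -- along that transposition; the coefficient records it for the latter.
      f-swap-fixed : ∀ i σ → σ ⟨$⟩ʳ suc i ≡ suc i →
        f σ + coefficient (suc i) (σ ⟨$⟩ʳ zero) ≈ f (swap zero (suc i) σ)
      f-swap-fixed i σ σi≡i = begin
        f σ + coefficient (suc i) (σ ⟨$⟩ʳ zero)   ≡⟨ cong (f σ +_) (coefficient-≢ σ0≢i) ⟩
        f σ + (f (swap zero (suc i) τ) - f τ)     ≈⟨ assoc _ _ _ ⟨
        (f σ + f (swap zero (suc i) τ)) - f τ     ≈⟨ +-congʳ (swap-difference-agree F (λ ()) σ τ
          (≡.sym (transpose-matchˡ zero (σ ⟨$⟩ʳ zero)))
          (≡.trans σi≡i (≡.sym (transpose-mismatch {i = zero} (λ ()) (≢-sym σ0≢i))))) ⟩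
        (f τ + f (swap zero (suc i) σ)) - f τ     ≈⟨ solve 3 (λ a b a⁻ → (a ⊕ b) ⊕ a⁻ ⊜ b ⊕ (a ⊕ a⁻)) refl (f τ) (f (swap zero (suc i) σ)) (- f τ) ⟩
        f (swap zero (suc i) σ) + (f τ - f τ)     ≈⟨ +-congˡ (inverseʳ (f τ)) ⟩
        f (swap zero (suc i) σ) + 0#              ≈⟨ identityʳ _ ⟩
        f (swap zero (suc i) σ)                   ∎
        where
        τ = swap zero (σ ⟨$⟩ʳ zero) Perm.id
        σ0≢i : σ ⟨$⟩ʳ zero ≢ suc i
        σ0≢i eq = contradiction (⟨$⟩ʳ-injective σ (≡.trans eq (≡.sym σi≡i))) λ ()

      -- With `r` the position of the value `suc i`, the alternating sum over `zero`, `suc i`, `r`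
      -- combines three differences along `pq`. Those at `qr σ` and `qr (pq σ)`, which fix `suc i`,
      -- are coefficients; the third is the one wanted.
      f-swap-moved : ∀ i σ → σ ⟨$⟩ʳ suc i ≢ suc i → σ ⟨$⟩ʳ zero ≢ suc i →
        f σ + coefficient (suc i) (σ ⟨$⟩ʳ zero) ≈
        f (swap zero (suc i) σ) + coefficient (suc i) (σ ⟨$⟩ʳ suc i)
      f-swap-moved i σ σi≢i σ0≢i = ∙-cancelʳ (f (qr σ) + f (qr (pq σ))) _ _ (begin
        (f σ + a₀) + (f (qr σ) + f (qr (pq σ)))
          ≈⟨ solve 4 (λ x y z w → (x ⊕ y) ⊕ (z ⊕ w) ⊜ (x ⊕ (z ⊕ y)) ⊕ w) refl (f σ) a₀ (f (qr σ)) (f (qr (pq σ))) ⟩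
        (f σ + (f (qr σ) + a₀)) + f (qr (pq σ))
          ≈⟨ +-congʳ (+-congˡ (trans (+-congˡ (reflexive (cong (coefficient (suc i)) (≡.sym qr-zero)))) (f-swap-fixed i (qr σ) qr-fixed))) ⟩
        (f σ + f (pq (qr σ))) + f (qr (pq σ))
          ≈⟨ alternating F (zero ∷ᵛ suc i ∷ᵛ r ∷ᵛ []ᵛ) (distinct₃ (λ ()) 0≢r i≢r) σ ⟩
        (f (pq σ) + f (qr σ)) + f (pr σ)
          ≈⟨ +-congˡ pr≈ ⟩
        (f (pq σ) + f (qr σ)) + f (pq (qr (pq σ)))
          ≈⟨ +-congˡ (trans (+-congˡ (reflexive (cong (coefficient (suc i)) (≡.sym qr-pq-zero)))) (f-swap-fixed i (qr (pq σ)) qr-pq-fixed)) ⟨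
        (f (pq σ) + f (qr σ)) + (f (qr (pq σ)) + aᵢ)
          ≈⟨ solve 4 (λ x y z w → (x ⊕ y) ⊕ (z ⊕ w) ⊜ (x ⊕ w) ⊕ (y ⊕ z)) refl (f (pq σ)) (f (qr σ)) (f (qr (pq σ))) aᵢ ⟩
        (f (pq σ) + aᵢ) + (f (qr σ) + f (qr (pq σ))) ∎)
        where
        r = σ ⟨$⟩ˡ suc i
        σr≡i : σ ⟨$⟩ʳ r ≡ suc i
        σr≡i = Perm.inverseʳ σ
        0≢r : zero ≢ r
        0≢r eq = σ0≢i (≡.trans (cong (σ ⟨$⟩ʳ_) eq) σr≡i)
        i≢r : suc i ≢ r
        i≢r eq = σi≢i (≡.trans (cong (σ ⟨$⟩ʳ_) eq) σr≡i)
        pq qr pr : Permutation′ (suc _) → Permutation′ (suc _)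
        pq = swap zero (suc i)
        qr = swap (suc i) r
        pr = swap zero r
        a₀ = coefficient (suc i) (σ ⟨$⟩ʳ zero)
        aᵢ = coefficient (suc i) (σ ⟨$⟩ʳ suc i)
        qr-zero : qr σ ⟨$⟩ʳ zero ≡ σ ⟨$⟩ʳ zero
        qr-zero = cong (σ ⟨$⟩ʳ_) (transpose-mismatch {i = suc i} (λ ()) 0≢r)
        qr-fixed : qr σ ⟨$⟩ʳ suc i ≡ suc i
        qr-fixed = ≡.trans (cong (σ ⟨$⟩ʳ_) (transpose-matchˡ (suc i) r)) σr≡i
        qr-pq-zero : qr (pq σ) ⟨$⟩ʳ zero ≡ σ ⟨$⟩ʳ suc i
        qr-pq-zero = ≡.trans (cong (pq σ ⟨$⟩ʳ_) (transpose-mismatch {i = suc i} (λ ()) 0≢r))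
          (cong (σ ⟨$⟩ʳ_) (transpose-matchˡ zero (suc i)))
        qr-pq-fixed : qr (pq σ) ⟨$⟩ʳ suc i ≡ suc i
        qr-pq-fixed = ≡.trans (cong (pq σ ⟨$⟩ʳ_) (transpose-matchˡ (suc i) r))
          (≡.trans (cong (σ ⟨$⟩ʳ_) (transpose-mismatch (≢-sym 0≢r) (≢-sym i≢r))) σr≡i)
        pr≈ : f (pr σ) ≈ f (pq (qr (pq σ)))
        pr≈ = congruent F (pr σ) (pq (qr (pq σ))) (act-cong (distinct₃ {i = zero} {suc i} {r} (λ ()) 0≢r i≢r)
          w₁ w₂ (from-yes (eval w₁ ≈? eval w₂)) σ)
          where
          w₁ w₂ : Word 3
          w₁ = (0F , 2F) ∷ []
          w₂ = (0F , 1F) ∷ (1F , 2F) ∷ (0F , 1F) ∷ []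

      f-swap : ∀ i σ → f σ + coefficient (suc i) (σ ⟨$⟩ʳ zero) ≈
        f (swap zero (suc i) σ) + coefficient (suc i) (σ ⟨$⟩ʳ suc i)
      f-swap i σ = by-cases (σ ⟨$⟩ʳ suc i ≟ suc i) (σ ⟨$⟩ʳ zero ≟ suc i)
        where
        s = swap zero (suc i)
        by-cases : Dec (σ ⟨$⟩ʳ suc i ≡ suc i) → Dec (σ ⟨$⟩ʳ zero ≡ suc i) →
          f σ + coefficient (suc i) (σ ⟨$⟩ʳ zero) ≈ f (s σ) + coefficient (suc i) (σ ⟨$⟩ʳ suc i)
        by-cases (no σi≢i) (no σ0≢i) = f-swap-moved i σ σi≢i σ0≢i
        by-cases (yes σi≡i) _ = begin
          f σ + coefficient (suc i) (σ ⟨$⟩ʳ zero)           ≈⟨ f-swap-fixed i σ σi≡i ⟩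
          f (s σ)                                           ≈⟨ identityʳ _ ⟨
          f (s σ) + 0#                                      ≈⟨ +-congˡ (coefficient-diagonal (suc i)) ⟨
          f (s σ) + coefficient (suc i) (suc i)             ≡⟨ cong (λ y → f (s σ) + coefficient (suc i) y) σi≡i ⟨
          f (s σ) + coefficient (suc i) (σ ⟨$⟩ʳ suc i)      ∎
        by-cases (no _) (yes σ0≡i) = begin
          f σ + coefficient (suc i) (σ ⟨$⟩ʳ zero)           ≡⟨ cong (λ y → f σ + coefficient (suc i) y) σ0≡i ⟩
          f σ + coefficient (suc i) (suc i)                 ≈⟨ +-congˡ (coefficient-diagonal (suc i)) ⟩
          f σ + 0#                                          ≈⟨ identityʳ _ ⟩
          f σ                                               ≈⟨ congruent F (s (s σ)) σ (λ l → cong (σ ⟨$⟩ʳ_)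
            (≡.trans (transpose-comm zero (suc i) (PC.transpose zero (suc i) l)) (PC.transpose-inverse (suc i) zero))) ⟨
          f (s (s σ))                                       ≈⟨ f-swap-fixed i (s σ) (≡.trans (cong (σ ⟨$⟩ʳ_) (transpose-matchʳ zero (suc i))) σ0≡i) ⟨
          f (s σ) + coefficient (suc i) (s σ ⟨$⟩ʳ zero)     ≡⟨ cong (λ y → f (s σ) + coefficient (suc i) (σ ⟨$⟩ʳ y)) (transpose-matchˡ zero (suc i)) ⟩
          f (s σ) + coefficient (suc i) (σ ⟨$⟩ʳ suc i)      ∎

      linearPart : Permutation′ (suc n) → Carrier
      linearPart σ = ∑[ i < suc n ] coefficient i (σ ⟨$⟩ʳ i)

      linearPart-swap : ∀ i σ → linearPart (swap zero (suc i) σ) + coefficient (suc i) (σ ⟨$⟩ʳ suc i) ≈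
        linearPart σ + coefficient (suc i) (σ ⟨$⟩ʳ zero)
      linearPart-swap i σ = trans
        (sum-differ (λ l → coefficient l (swap zero (suc i) σ ⟨$⟩ʳ l)) (λ l → coefficient l (σ ⟨$⟩ʳ l)) (suc i)
          λ { zero    _   → refl
            ; (suc l) l≢i → reflexive (cong (λ y → coefficient (suc l) (σ ⟨$⟩ʳ y)) (transpose-mismatch {i = zero} (λ ()) l≢i)) })
        (+-congˡ (reflexive (cong (λ y → coefficient (suc i) (σ ⟨$⟩ʳ y)) (transpose-matchʳ zero (suc i)))))

      remainder : Permutation′ (suc n) → Carrier
      remainder σ = f σ - linearPart σ

      remainder-cong : ∀ σ τ → σ Perm.≈ τ → remainder σ ≈ remainder τ
      remainder-cong σ τ σ≈τ = +-cong (congruent F σ τ σ≈τ)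
        (⁻¹-cong (sum-cong-≋ λ i → reflexive (cong (coefficient i) (σ≈τ i))))

      remainder-swap-zero : ∀ i σ → remainder (swap zero (suc i) σ) ≈ remainder σ
      remainder-swap-zero i σ = difference (∙-cancelʳ (aᵢ + a₀) _ _ (begin
        (f (s σ) + linearPart σ) + (aᵢ + a₀)     ≈⟨ solve 4 (λ x y z w → (x ⊕ y) ⊕ (z ⊕ w) ⊜ (x ⊕ z) ⊕ (y ⊕ w)) refl (f (s σ)) (linearPart σ) aᵢ a₀ ⟩
        (f (s σ) + aᵢ) + (linearPart σ + a₀)     ≈⟨ +-cong (f-swap i σ) (linearPart-swap i σ) ⟨
        (f σ + a₀) + (linearPart (s σ) + aᵢ)     ≈⟨ solve 4 (λ x y z w → (x ⊕ w) ⊕ (y ⊕ z) ⊜ (x ⊕ y) ⊕ (z ⊕ w)) refl (f σ) (linearPart (s σ)) aᵢ a₀ ⟩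
        (f σ + linearPart (s σ)) + (aᵢ + a₀)     ∎))
        where
        s = swap zero (suc i)
        a₀ = coefficient (suc i) (σ ⟨$⟩ʳ zero)
        aᵢ = coefficient (suc i) (σ ⟨$⟩ʳ suc i)

      remainder-swap : ∀ i j → i ≢ j → ∀ σ → remainder (swap i j σ) ≈ remainder σ
      remainder-swap zero    zero    0≢0 σ = contradiction ≡.refl 0≢0
      remainder-swap zero    (suc j) _   σ = remainder-swap-zero j σ
      remainder-swap (suc i) zero    _   σ = trans
        (remainder-cong (swap (suc i) zero σ) (swap zero (suc i) σ) (λ l → cong (σ ⟨$⟩ʳ_) (transpose-comm (suc i) zero l)))
        (remainder-swap-zero i σ)
      remainder-swap (suc i) (suc j) i≢j σ = begin
        remainder (swap (suc i) (suc j) σ)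
          ≈⟨ remainder-cong (swap (suc i) (suc j) σ) (s (t (s σ))) (act-cong (distinct₃ {i = zero} {suc i} {suc j} (λ ()) (λ ()) i≢j)
               w₁ w₂ (from-yes (eval w₁ ≈? eval w₂)) σ) ⟩
        remainder (s (t (s σ)))   ≈⟨ remainder-swap-zero i (t (s σ)) ⟩
        remainder (t (s σ))       ≈⟨ remainder-swap-zero j (s σ) ⟩
        remainder (s σ)           ≈⟨ remainder-swap-zero i σ ⟩
        remainder σ               ∎
        where
        s = swap zero (suc i)
        t = swap zero (suc j)
        w₁ w₂ : Word 3
        w₁ = (1F , 2F) ∷ []
        w₂ = (0F , 1F) ∷ (0F , 2F) ∷ (0F , 1F) ∷ []

      affine : ∀ σ → f σ ≈ remainder Perm.id + linearPart σ
      affine σ = begin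
        f σ                                       ≈⟨ identityʳ _ ⟨
        f σ + 0#                                  ≈⟨ +-congˡ (inverseˡ (linearPart σ)) ⟨
        f σ + (- linearPart σ + linearPart σ)     ≈⟨ assoc _ _ _ ⟨
        -- With an empty `Fixed`, all transpositions are available and connect `σ` to the identity.
        remainder σ + linearPart σ                ≈⟨ +-congʳ (agreement remainder-cong (λ _ → Empty.⊥) (λ i j i≢j _ _ → remainder-swap i j i≢j) σ Perm.id λ _ ()) ⟩
        remainder Perm.id + linearPart σ          ∎

-- Real-valued functions

open import Defs

private module R = CommutativeRing ℝ-commutativeRing
open RingProperties R.ring using (-‿distribʳ-*; x∙y⁻¹≈ε⇒x≈y)
open CommutativeSemigroupProperties R.*-commutativeSemigroup using (x∙yz≈y∙xz)
open SemiringSum R.semiring using (*-distribˡ-sum; *-distribʳ-sum; ∑-distrib-+; ∑-comm; sum-replicate-zero)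
open Balance R.+-abelianGroup using (Balanced; sum-neg)
open Balanced
open import Relation.Binary.Reasoning.Setoid ℝ-setoid

2-torsion-free : ∀ z → z +ℝ z ≈ℝ 0ℝ → z ≈ℝ 0ℝ
2-torsion-free z 2z≈0 = begin
  z                        ≈⟨ pointwise (λ k → ½+½ (seq z k)) ⟨
  fromℚ ½ *ℝ z +ℝ fromℚ ½ *ℝ z   ≈⟨ R.distribˡ (fromℚ ½) z z ⟨
  fromℚ ½ *ℝ (z +ℝ z)      ≈⟨ *ℝ-cong ≈ℝ-refl 2z≈0 ⟩
  fromℚ ½ *ℝ 0ℝ            ≈⟨ R.zeroʳ (fromℚ ½) ⟩
  0ℝ                       ∎

open Balance.TorsionFree R.+-abelianGroup 2-torsion-free using (affine; remainder; coefficient)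

-- One-factorizations from pairwise disjoint families

witness : ∀ {A : Set} (A? : Dec A) → does A? ≡ true → A
witness (yes a) _ = a

pairwiseDisjoint⇒injective : ∀ {e : Fin n → Permutation′ n} → PairwiseDisjoint e →
  ∀ {i j} → e i Perm.≈ e j → i ≡ j
pairwiseDisjoint⇒injective e-disjoint {i} {j} ei≈ej =
  -- The index `i` doubles as a position, as the family has one member per position.
  decidable-stable (i ≟ j) λ i≢j → e-disjoint i≢j i (ei≈ej i)

-- Membership is a finite search, hence decidable, and a successful search returns the index, which
-- disjointness makes unique.
oneFactorization : ∀ {e : Fin n → Permutation′ n} → PairwiseDisjoint e → OneFactorization n
oneFactorization {n} {e} e-disjoint = record
  { characteristic = record
    { to   = λ σ → does (member? σ)
    ; cong = λ {σ} {τ} σ≈τ → does-⇔ (mk⇔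
        (λ (k , ek≈σ) → k , λ l → ≡.trans (ek≈σ l) (σ≈τ l))
        (λ (k , ek≈τ) → k , λ l → ≡.trans (ek≈τ l) (≡.sym (σ≈τ l)))) (member? σ) (member? τ)
    }
  ; enumeration = record
    { to        = λ k → e k , dec-true (member? (e k)) (k , λ _ → ≡.refl)
    ; from      = index
    ; to-cong   = λ { ≡.refl _ → ≡.refl }
    ; from-cong = λ {s} {t} σ≈τ → injective λ l →
        ≡.trans (index-inverse s l) (≡.trans (σ≈τ l) (≡.sym (index-inverse t l)))
    ; inverse   = (λ { {s} ≡.refl → index-inverse s })
                , (λ {k} {s} σ≈ek → injective λ l → ≡.trans (index-inverse s l) (σ≈ek l))
    }
  ; disjoint = λ σ τ σ∈ τ∈ σ≉τ l eq →
      e-disjoint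
        (λ i≡j → σ≉τ λ m → ≡.trans (≡.sym (index-inverse (σ , σ∈) m))
          (≡.trans (cong (λ i → e i ⟨$⟩ʳ m) i≡j) (index-inverse (τ , τ∈) m)))
        l (≡.trans (index-inverse (σ , σ∈) l) (≡.trans eq (≡.sym (index-inverse (τ , τ∈) l))))
  }
  where
  member? : ∀ σ → Dec (∃[ k ] (∀ l → e k ⟨$⟩ʳ l ≡ σ ⟨$⟩ʳ l))
  member? σ = any? λ k → all? λ l → e k ⟨$⟩ʳ l ≟ σ ⟨$⟩ʳ l
  index : Σ[ σ ∈ Permutation′ n ] does (member? σ) ≡ true → Fin n
  index (σ , σ∈) = proj₁ (witness (member? σ) σ∈)
  index-inverse : ∀ s → e (index s) Perm.≈ proj₁ s
  index-inverse (σ , σ∈) = proj₂ (witness (member? σ) σ∈)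
  injective = pairwiseDisjoint⇒injective {e = e} e-disjoint

ConstantSums : Fun n → Set
ConstantSums {n} f = (L L′ : OneFactorization n) → sumOver L (f $$_) ≈ℝ sumOver L′ (f $$_)

-- Enumerating `oneFactorization` gives back the family by computation, so the sums match
-- definitionally.
constantSums⇒balanced : ∀ (f : Fun n) → ConstantSums f → Balanced (f $$_)
constantSums⇒balanced f constant = record
  { congruent = λ _ _ → Func.cong f
  ; balanced  = λ d e d-disjoint e-disjoint →
      constant (oneFactorization {e = d} d-disjoint) (oneFactorization {e = e} e-disjoint)
  }

-- Sums over a one-factorization as inner products

module _ (L : OneFactorization n) where

  open OneFactorization L

  element-injective : ∀ {k l} → element k Perm.≈ element l → k ≡ l
  element-injective {k} {l} eq = ≡.trans (≡.sym (Inverse.inverseʳ enumeration (λ _ → ≡.refl)))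
    (Inverse.inverseʳ enumeration {x = l} {y = Inverse.to enumeration k} eq)

  -- Distinct elements differ at `i`, so their n values there form a permutation and exactly one of
  -- them is `j`.
  ∑-x-element : ∀ i j → ∑[ l < n ] (x i j $$ element l) ≈ℝ 1ℝ
  ∑-x-element i j with injective⇒permutation (λ l → element l ⟨$⟩ʳ i) injective
    where
    injective : Injective _≡_ _≡_ (λ l → element l ⟨$⟩ʳ i)
    injective {k} {l} eq = decidable-stable (k ≟ l) λ k≢l →
      disjoint (element k) (element l) (proj₂ (Inverse.to enumeration k)) (proj₂ (Inverse.to enumeration l))
        (λ ek≈el → k≢l (element-injective ek≈el)) i eq
  ... | π , π≡ = begin
    ∑[ l < n ] indicator (does (element l ⟨$⟩ʳ i ≟ j))
      ≈⟨ sum-cong-≋ (λ l → R.reflexive (cong indicator (does-⇔ (mk⇔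
           (λ eq → ≡.trans (cong (π ⟨$⟩ˡ_) (≡.trans (≡.sym eq) (≡.sym (π≡ l)))) (Perm.inverseˡ π))
           (λ eq → ≡.trans (≡.sym (π≡ l)) (≡.trans (cong (π ⟨$⟩ʳ_) (≡.sym eq)) (Perm.inverseʳ π))))
           (element l ⟨$⟩ʳ i ≟ j) (π ⟨$⟩ˡ j ≟ l)))) ⟩
    ∑[ l < n ] indicator (does (π ⟨$⟩ˡ j ≟ l))
      ≈⟨ ∑-point R.+-commutativeMonoid (λ _ → 1ℝ) (π ⟨$⟩ˡ j) ⟩
    1ℝ ∎

  -- `φ` places the elements of `L` in the enumeration of the symmetric group. The indicator becomes
  -- a sum of point masses at the `φ l`, and the summations are exchanged.
  ⟨,v⟩ : ∀ (f : Fun n) → ⟨ f , v L ⟩ ≈ℝ sumOver L (f $$_)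
  ⟨,v⟩ f = begin
    ∑[ k < n ! ] (f $$ permAt n k *ℝ indicator (Func.to characteristic (permAt n k)))
      ≈⟨ sum-cong-≋ expand ⟩
    ∑[ k < n ! ] ∑[ l < n ] (if does (φ l ≟ k) then f $$ permAt n k else 0ℝ)
      ≈⟨ ∑-comm (λ k l → if does (φ l ≟ k) then f $$ permAt n k else 0ℝ) ⟩
    ∑[ l < n ] ∑[ k < n ! ] (if does (φ l ≟ k) then f $$ permAt n k else 0ℝ)
      ≈⟨ sum-cong-≋ (λ l → ≈ℝ-trans (∑-point R.+-commutativeMonoid (λ k → f $$ permAt n k) (φ l))
           (Func.cong f (permAt-permIndex n (element l)))) ⟩
    ∑[ l < n ] (f $$ element l) ∎
    where
    φ : Fin n → Fin (n !)
    φ l = permIndex n (element l)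
    φ≡⇒≈ : ∀ {l k} → φ l ≡ k → element l Perm.≈ permAt n k
    φ≡⇒≈ {l} ≡.refl i = ≡.sym (permAt-permIndex n (element l) i)
    ≈⇒φ≡ : ∀ {l k} → element l Perm.≈ permAt n k → φ l ≡ k
    ≈⇒φ≡ {l} {k} eq = ≡.trans (permIndex-cong n {element l} {permAt n k} eq) (permIndex-permAt n k)
    expand : ∀ k → f $$ permAt n k *ℝ indicator (Func.to characteristic (permAt n k)) ≈ℝ
      ∑[ l < n ] (if does (φ l ≟ k) then f $$ permAt n k else 0ℝ)
    expand k with Func.to characteristic (permAt n k) in member
    ... | true = begin
      f $$ permAt n k *ℝ 1ℝ
        ≈⟨ R.*-identityʳ _ ⟩
      f $$ permAt n k
        ≈⟨ ∑-point R.+-commutativeMonoid (λ _ → f $$ permAt n k) l₀ ⟨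
      ∑[ l < n ] (if does (l₀ ≟ l) then f $$ permAt n k else 0ℝ)
        ≈⟨ sum-cong-≋ (λ l → R.reflexive (cong (if_then f $$ permAt n k else 0ℝ) (does-⇔ (mk⇔
             (λ { ≡.refl → ≈⇒φ≡ l₀≈ })
             (λ eq → Inverse.inverseʳ enumeration {x = l} {y = s} (λ i → ≡.sym (φ≡⇒≈ eq i))))
             (l₀ ≟ l) (φ l ≟ k)))) ⟩
      ∑[ l < n ] (if does (φ l ≟ k) then f $$ permAt n k else 0ℝ) ∎
      where
      s : Σ[ σ ∈ Permutation′ n ] Member σ
      s = permAt n k , member
      l₀ : Fin n
      l₀ = Inverse.from enumeration s
      l₀≈ : element l₀ Perm.≈ permAt n k
      l₀≈ = Inverse.inverseˡ enumeration {x = s} ≡.refl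
    ... | false = begin
      f $$ permAt n k *ℝ 0ℝ       ≈⟨ R.zeroʳ _ ⟩
      0ℝ                          ≈⟨ sum-replicate-zero n ⟨
      ∑[ l < n ] 0ℝ               ≈⟨ sum-cong-≋ (λ l → R.reflexive (cong (if_then f $$ permAt n k else 0ℝ)
        (≡.sym (dec-false (φ l ≟ k) (λ eq → nonmember l (φ≡⇒≈ eq)))))) ⟩
      ∑[ l < n ] (if does (φ l ≟ k) then f $$ permAt n k else 0ℝ) ∎
      where
      nonmember : ∀ l → ¬ (element l Perm.≈ permAt n k)
      nonmember l eq = contradiction (≡.trans (≡.sym (proj₂ (Inverse.to enumeration l)))
        (≡.trans (Func.cong characteristic eq) member)) λ ()

⟨,v-v⟩ : ∀ (f : Fun n) L L′ →
  ⟨ f , v L -ᶠ v L′ ⟩ ≈ℝ sumOver L (f $$_) -ℝ sumOver L′ (f $$_)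
⟨,v-v⟩ {n} f L L′ = begin
  ∑[ p < n ! ] (F p *ℝ (a p -ℝ b p))
    ≈⟨ sum-cong-≋ (λ p → ≈ℝ-trans (R.distribˡ (F p) (a p) (-ℝ b p)) (R.+-congˡ (≈ℝ-sym (-‿distribʳ-* (F p) (b p))))) ⟩
  ∑[ p < n ! ] (F p *ℝ a p +ℝ -ℝ (F p *ℝ b p))
    ≈⟨ ∑-distrib-+ (λ p → F p *ℝ a p) (λ p → -ℝ (F p *ℝ b p)) ⟩
  ⟨ f , v L ⟩ +ℝ ∑[ p < n ! ] (-ℝ (F p *ℝ b p))
    ≈⟨ R.+-congˡ (sum-neg (λ p → F p *ℝ b p)) ⟩
  ⟨ f , v L ⟩ -ℝ ⟨ f , v L′ ⟩
    ≈⟨ +ℝ-cong (⟨,v⟩ L f) (-ℝ-cong (⟨,v⟩ L′ f)) ⟩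
  sumOver L (f $$_) -ℝ sumOver L′ (f $$_) ∎
  where
  F a b : Fin (n !) → ℝ
  F p = f $$ permAt n p
  a p = v L $$ permAt n p
  b p = v L′ $$ permAt n p

*-if : ∀ a b → a *ℝ indicator b ≈ℝ (if b then a else 0ℝ)
*-if a true  = R.*-identityʳ a
*-if a false = R.zeroʳ a

sum-↑ : ∀ m (h : Fin (m ℕ.+ n) → ℝ) → sum h ≈ℝ ∑[ i < m ] h (i ↑ˡ n) +ℝ ∑[ j < n ] h (m ↑ʳ j)
sum-↑ zero    h = ≈ℝ-sym (R.+-identityˡ _)
sum-↑ (suc m) h = ≈ℝ-trans (R.+-congˡ (sum-↑ m (h ∘ suc))) (≈ℝ-sym (R.+-assoc _ _ _))

sum-combine : ∀ m n (h : Fin (m ℕ.* n) → ℝ) → sum h ≈ℝ ∑[ i < m ] ∑[ j < n ] h (combine i j)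
sum-combine zero    n h = ≈ℝ-refl
sum-combine (suc m) n h = ≈ℝ-trans (sum-↑ n h) (R.+-congˡ (sum-combine m n (h ∘ (n ↑ʳ_))))

-- Orthogonality, span and affine form

constantSums⇒⊥ : ∀ (f : Fun n) → ConstantSums f → f ∈ (T n) ⊥
constantSums⇒⊥ {n} f constant g (m , c , ι , g≈) = begin
  ∑[ p < n ! ] (f $$ permAt n p *ℝ g $$ permAt n p)
    ≈⟨ sum-cong-≋ (λ p → expand (permAt n p)) ⟩
  ∑[ p < n ! ] ∑[ k < m ] (c k *ℝ (f $$ permAt n p *ℝ w k $$ permAt n p))
    ≈⟨ ∑-comm (λ p k → c k *ℝ (f $$ permAt n p *ℝ w k $$ permAt n p)) ⟩
  ∑[ k < m ] ∑[ p < n ! ] (c k *ℝ (f $$ permAt n p *ℝ w k $$ permAt n p))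
    ≈⟨ sum-cong-≋ (λ k → ≈ℝ-sym (*-distribˡ-sum (c k) (λ p → f $$ permAt n p *ℝ w k $$ permAt n p))) ⟩
  ∑[ k < m ] (c k *ℝ ⟨ f , w k ⟩)
    ≈⟨ sum-cong-≋ (λ k → ≈ℝ-trans (R.*-congˡ (orthogonal (proj₁ (ι k)) (proj₂ (ι k)))) (R.zeroʳ (c k))) ⟩
  ∑[ k < m ] 0ℝ
    ≈⟨ sum-replicate-zero m ⟩
  0ℝ ∎
  where
  w : Fin m → Fun n
  w k = v (proj₁ (ι k)) -ᶠ v (proj₂ (ι k))
  orthogonal : ∀ L L′ → ⟨ f , v L -ᶠ v L′ ⟩ ≈ℝ 0ℝ
  orthogonal L L′ = begin
    ⟨ f , v L -ᶠ v L′ ⟩                        ≈⟨ ⟨,v-v⟩ f L L′ ⟩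
    sumOver L (f $$_) -ℝ sumOver L′ (f $$_)    ≈⟨ R.+-congʳ (constant L L′) ⟩
    sumOver L′ (f $$_) -ℝ sumOver L′ (f $$_)   ≈⟨ R.-‿inverseʳ _ ⟩
    0ℝ                                         ∎
  expand : ∀ σ → f $$ σ *ℝ g $$ σ ≈ℝ ∑[ k < m ] (c k *ℝ (f $$ σ *ℝ w k $$ σ))
  expand σ = begin
    f $$ σ *ℝ g $$ σ                              ≈⟨ R.*-congˡ (g≈ σ) ⟩
    f $$ σ *ℝ ∑[ k < m ] (c k *ℝ w k $$ σ)        ≈⟨ *-distribˡ-sum (f $$ σ) (λ k → c k *ℝ w k $$ σ) ⟩
    ∑[ k < m ] (f $$ σ *ℝ (c k *ℝ w k $$ σ))      ≈⟨ sum-cong-≋ (λ k → x∙yz≈y∙xz (f $$ σ) (c k) (w k $$ σ)) ⟩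
    ∑[ k < m ] (c k *ℝ (f $$ σ *ℝ w k $$ σ))      ∎

⊥⇒constantSums : ∀ (f : Fun n) → f ∈ (T n) ⊥ → ConstantSums f
⊥⇒constantSums f f⊥T L L′ = x∙y⁻¹≈ε⇒x≈y _ _ (begin
  sumOver L (f $$_) -ℝ sumOver L′ (f $$_)   ≈⟨ ⟨,v-v⟩ f L L′ ⟨
  ⟨ f , v L -ᶠ v L′ ⟩                       ≈⟨ f⊥T (v L -ᶠ v L′) (1 , (λ _ → 1ℝ) , (λ _ → L , L′) , λ σ →
    ≈ℝ-sym (≈ℝ-trans (R.+-identityʳ _) (R.*-identityˡ _))) ⟩
  0ℝ                                        ∎)

-- Each `x i j` sums to 1 over any one-factorization, so the total is the sum of the coefficients.
U⇒constantSums : ∀ (f : Fun n) → f ∈ U n → ConstantSums f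
U⇒constantSums {n} f (m , c , ι , f≈) L L′ = ≈ℝ-trans (total L) (≈ℝ-sym (total L′))
  where
  total : ∀ L → sumOver L (f $$_) ≈ℝ sum c
  total L = begin
    ∑[ l < n ] (f $$ e l)
      ≈⟨ sum-cong-≋ (λ l → f≈ (e l)) ⟩
    ∑[ l < n ] ∑[ k < m ] (c k *ℝ uncurry x (ι k) $$ e l)
      ≈⟨ ∑-comm (λ l k → c k *ℝ uncurry x (ι k) $$ e l) ⟩
    ∑[ k < m ] ∑[ l < n ] (c k *ℝ uncurry x (ι k) $$ e l)
      ≈⟨ sum-cong-≋ (λ k → ≈ℝ-sym (*-distribˡ-sum (c k) (λ l → uncurry x (ι k) $$ e l))) ⟩
    ∑[ k < m ] (c k *ℝ ∑[ l < n ] (uncurry x (ι k) $$ e l))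
      ≈⟨ sum-cong-≋ (λ k → ≈ℝ-trans (R.*-congˡ (∑-x-element L (proj₁ (ι k)) (proj₂ (ι k)))) (R.*-identityʳ (c k))) ⟩
    sum c ∎
    where e = OneFactorization.element L

Affine : Fun n → Set
Affine {n} f = Σ[ c ∈ ℝ ] Σ[ a ∈ (Fin n → Fin n → ℝ) ]
  (∀ (σ : Permutation′ n) → f $$ σ ≈ℝ c +ℝ (∑[ i < n ] a i (σ ⟨$⟩ʳ i)))

constantSums⇒affine : ∀ (f : Fun (suc n)) → ConstantSums f → Affine f
constantSums⇒affine f constant =
  remainder balanced-f Perm.id , coefficient balanced-f , affine balanced-f
  where balanced-f = constantSums⇒balanced f constant

-- The constant is absorbed into row 0, since exactly one `x zero j` is 1 at each permutation. The
-- double sum is flattened along `combine` because `Span` uses a single index.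
affine⇒U : ∀ (f : Fun (suc n)) → Affine f → f ∈ U (suc n)
affine⇒U {n} f (c , a , f≈) = N ℕ.* N , entry , remQuot N , λ σ → begin
  f $$ σ
    ≈⟨ f≈ σ ⟩
  c +ℝ ∑[ i < N ] a i (σ ⟨$⟩ʳ i)
    ≈⟨ R.+-congʳ (∑-point R.+-commutativeMonoid (λ _ → c) (zero {n})) ⟨
  ∑[ i < N ] (if does (zero ≟ i) then c else 0ℝ) +ℝ ∑[ i < N ] a i (σ ⟨$⟩ʳ i)
    ≈⟨ ∑-distrib-+ (λ i → if does (zero ≟ i) then c else 0ℝ) (λ i → a i (σ ⟨$⟩ʳ i)) ⟨
  ∑[ i < N ] b i (σ ⟨$⟩ʳ i)
    ≈⟨ sum-cong-≋ (λ i → ≈ℝ-sym (≈ℝ-trans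
         (sum-cong-≋ (λ j → *-if (b i j) (does (σ ⟨$⟩ʳ i ≟ j))))
         (∑-point R.+-commutativeMonoid (b i) (σ ⟨$⟩ʳ i)))) ⟩
  ∑[ i < N ] ∑[ j < N ] (b i j *ℝ x i j $$ σ)
    ≈⟨ sum-cong-≋ (λ i → sum-cong-≋ λ j → R.reflexive (cong
         (λ (i , j) → b i j *ℝ x i j $$ σ) (≡.sym (remQuot-combine i j)))) ⟩
  ∑[ i < N ] ∑[ j < N ] (entry (combine i j) *ℝ uncurry x (remQuot N (combine i j)) $$ σ)
    ≈⟨ sum-combine N N (λ k → entry k *ℝ uncurry x (remQuot N k) $$ σ) ⟨
  ∑[ k < N ℕ.* N ] (entry k *ℝ uncurry x (remQuot N k) $$ σ) ∎
  where
  N = suc n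
  b : Fin N → Fin N → ℝ
  b i j = (if does (zero ≟ i) then c else 0ℝ) +ℝ a i j
  entry : Fin (N ℕ.* N) → ℝ
  entry k = uncurry b (remQuot N k)

theorem1p2 : ∀ (n : ℕ) → 2 ≤ n →
    (U n ≐ (T n) ⊥)
    × (∀ (f : Fun n) →
    (f ∈ U n ⇔ (∀ (L L′ : OneFactorization n) → sumOver L (f $$_) ≈ℝ sumOver L′ (f $$_)))
    × (f ∈ U n ⇔ (Σ[ c ∈ ℝ ] Σ[ a ∈ (Fin n → Fin n → ℝ) ]
    (∀ (σ : Permutation′ n) → f $$ σ ≈ℝ c +ℝ (∑[ i < n ] a i (σ ⟨$⟩ʳ i))))))
theorem1p2 (suc n) _ =
  ((λ {f} f∈U → constantSums⇒⊥ f (U⇒constantSums f f∈U)) , λ {f} f⊥T → constantSums⇒U f (⊥⇒constantSums f f⊥T))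
  , λ f → mk⇔ (U⇒constantSums f) (constantSums⇒U f)
        , mk⇔ (constantSums⇒affine f ∘ U⇒constantSums f) (affine⇒U f)
  where
  constantSums⇒U : ∀ f → ConstantSums f → f ∈ U (suc n)
  constantSums⇒U f = affine⇒U f ∘ constantSums⇒affine f
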